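{- Let $n\ge1$ and $D_n^{(\mathsf{cyc},\mathsf{exc})}(q,t)=\sum_{\sigma\in\mathfrak{D}_n}q^{\mathsf{cyc}\,\sigma}t^{\mathsf{exc}\,\sigma}$. Then $$D_{n}^{(\mathsf{cyc}, \mathsf{exc})}(q, t)=\left(\frac{1+xt}{1+x}\right)^{n}P^{(\mathsf{cyc}, \mathsf{cpk},\mathsf{exc})}\left(\mathfrak{D}_n; q, \frac{(1+x)^{2}t}{(x+t)(1+xt)},\frac{x+t}{1+xt}\right),$$ equivalently, $$P^{(\mathsf{cyc}, \mathsf{cpk},\mathsf{exc})}(\mathfrak{D}_n; q, x,t)=\left(\frac{1+u}{1+uv}\right)^{n}D_{n}^{(\mathsf{cyc}, \mathsf{exc})}(q, v),$$ where $u=\frac{1+t^{2}-2xt-(1-t)\sqrt{(1+t)^{2}-4xt}}{2(1-x)t}$ and $v=\frac{(1+t)^{2}-2xt-(1+t)\sqrt{(1+t)^{2}-4xt}}{2xt}$.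
   Context: $\mathfrak{D}_n$ is the set of derangements of $[n]$ (permutations with no fixed point). $P^{(\mathsf{stat}_1,\ldots,\mathsf{stat}_m)}(\Omega;t_1,\ldots,t_m)=\sum_{\sigma\in\Omega}\prod_j t_j^{\mathsf{stat}_j\sigma}$. For a permutation $\sigma$: $\mathsf{cyc}\,\sigma$ is its number of cycles, $\mathsf{exc}\,\sigma=\#\{i:\sigma(i)>i\}$, and $\mathsf{cpk}\,\sigma$ is the number of cyclic peaks, i.e. values $x$ with $\sigma^{ -1}(x)<x>\sigma(x)$. -}

module Defs where

open import Algebra.Bundles using (CommutativeRing)
import Algebra.Definitions as AlgDefs
import Algebra.Properties.Semiring.Exp as Exp
open import Data.Fin.Base using (Fin; zero; suc; toℕ; fromℕ<; _<_)
open import Data.Fin.Permutation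
  using (Permutation′; _⟨$⟩ʳ_; _⟨$⟩ˡ_; _≈_; id; _∘ₚ_; transpose; lift₀; remove; lift₀-remove)
import Data.Fin.Permutation.Components as PC
open import Data.Fin.Properties using (_≟_; _<?_; all?; pigeonhole; toℕ<n; suc-injective)
open import Data.List.Base using (List; []; _∷_; length; filter; map; foldr; allFin; cartesianProductWith; deduplicate)
import Data.List.Membership.Setoid as Membership
import Data.List.Membership.Setoid.Properties as Membershipₚ
open import Data.List.Membership.Propositional.Properties using (∈-allFin)
open import Data.List.Relation.Unary.All using ([])
open import Data.List.Relation.Unary.AllPairs using ([]; _∷_)
open import Data.List.Relation.Unary.Any using (here)
import Data.List.Relation.Unary.Unique.Setoid as Unique
import Data.List.Relation.Unary.Unique.Setoid.Properties as Uniqueₚ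
import Data.List.Relation.Unary.Unique.Propositional.Properties as Uniqueₚₚ
open import Data.Nat.Base as ℕ using (ℕ; zero; suc)
open import Data.Nat.GeneralisedArithmetic using (fold; fold-+)
open import Data.Nat.Induction using (<-rec)
import Data.Nat.Properties as ℕₚ
open import Data.Product.Base using (∃; _×_; _,_; proj₁; proj₂)
open import Data.Vec.Base as Vec using (Vec)
open import Function.Base using (_∘_)
open import Level using (0ℓ)
open import Relation.Binary.Bundles using (Setoid)
open import Relation.Binary.PropositionalEquality
  using (_≡_; _≢_; refl; sym; trans; cong; subst; setoid; module ≡-Reasoning)
open import Relation.Nullary.Decidable using (Dec; yes; no; map′; ¬?; _×-dec_)
open import Relation.Unary using (Pred; Decidable)

-- The letters 1, …, n are represented, in order, by the elements of Fin n.

permutationSetoid : ℕ → Setoid 0ℓ 0ℓ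
permutationSetoid n = record
  { Carrier       = Permutation′ n
  ; _≈_           = _≈_
  ; isEquivalence = record
    { refl  = λ i → refl
    ; sym   = λ p i → sym (p i)
    ; trans = λ p q i → trans (p i) (q i)
    }
  }

-- extend j π fixes zero and acts as π elsewhere, then exchanges zero and j.

extend : ∀ {n} → Fin (suc n) → Permutation′ n → Permutation′ (suc n)
extend j π = lift₀ π ∘ₚ transpose zero j

-- Every permutation of Fin n, listed once up to pointwise equality (see
-- permutations-complete and permutations-unique).

permutations : ∀ n → List (Permutation′ n)
permutations zero    = id ∷ []
permutations (suc n) = cartesianProductWith extend (allFin (suc n)) (permutations n)

private
  extend-cong : ∀ {n} {j k : Fin (suc n)} {π ρ : Permutation′ n} →
                j ≡ k → π ≈ ρ → extend j π ≈ extend k ρ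
  extend-cong refl π≈ρ zero    = refl
  extend-cong {j = j} refl π≈ρ (suc i) = cong (λ l → PC.transpose zero j (suc l)) (π≈ρ i)

  extend-injective : ∀ {n} {j k : Fin (suc n)} {π ρ : Permutation′ n} →
                     extend j π ≈ extend k ρ → j ≡ k × π ≈ ρ
  extend-injective {j = j} {k} {π} {ρ} eq with refl ← eq zero = refl , λ i →
    suc-injective (begin
      suc (π ⟨$⟩ʳ i)
        ≡⟨ PC.transpose-inverse j zero ⟨
      PC.transpose j zero (PC.transpose zero j (suc (π ⟨$⟩ʳ i)))
        ≡⟨ cong (PC.transpose j zero) (eq (suc i)) ⟩
      PC.transpose j zero (PC.transpose zero j (suc (ρ ⟨$⟩ʳ i)))
        ≡⟨ PC.transpose-inverse j zero ⟩
      suc (ρ ⟨$⟩ʳ i) ∎)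
    where open ≡-Reasoning

  unextend : ∀ {n} → Permutation′ (suc n) → Permutation′ n
  unextend σ = remove zero (σ ∘ₚ transpose (σ ⟨$⟩ʳ zero) zero)

  transpose-first : ∀ {n} (i j : Fin n) → PC.transpose i j i ≡ j
  transpose-first i j with i ≟ i
  ... | yes _  = refl
  ... | no i≢i with () ← i≢i refl

  extend-unextend : ∀ {n} (σ : Permutation′ (suc n)) →
                    σ ≈ extend (σ ⟨$⟩ʳ zero) (unextend σ)
  extend-unextend σ i = sym (begin
    PC.transpose zero j (lift₀ (unextend σ) ⟨$⟩ʳ i)
      ≡⟨ cong (PC.transpose zero j)
           (lift₀-remove (σ ∘ₚ transpose j zero) (transpose-first j zero) i) ⟩
    PC.transpose zero j (PC.transpose j zero (σ ⟨$⟩ʳ i))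
      ≡⟨ PC.transpose-inverse zero j ⟩
    σ ⟨$⟩ʳ i ∎)
    where
    open ≡-Reasoning
    j = σ ⟨$⟩ʳ zero

permutations-complete : ∀ {n} (σ : Permutation′ n) →
                        Membership._∈_ (permutationSetoid n) σ (permutations n)
permutations-complete {zero}  σ = here λ ()
permutations-complete {suc n} σ =
  Membershipₚ.∈-resp-≈ (permutationSetoid (suc n))
    {x = extend (σ ⟨$⟩ʳ zero) (unextend σ)} {y = σ}
    (λ i → sym (extend-unextend σ i))
    (Membershipₚ.∈-cartesianProductWith⁺
      (setoid (Fin (suc n))) (permutationSetoid n) (permutationSetoid (suc n))
      (λ {_} {_} {π} {ρ} → extend-cong {π = π} {ρ})
      (∈-allFin (σ ⟨$⟩ʳ zero)) (permutations-complete (unextend σ)))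

permutations-unique : ∀ n → Unique.Unique (permutationSetoid n) (permutations n)
permutations-unique zero    = [] ∷ []
permutations-unique (suc n) =
  Uniqueₚ.cartesianProductWith⁺
    (setoid (Fin (suc n))) (permutationSetoid n) (permutationSetoid (suc n)) extend
    (λ {_} {_} {π} {ρ} → extend-injective {π = π} {ρ})
    (Uniqueₚₚ.allFin⁺ (suc n)) (permutations-unique n)

IsDerangement : ∀ {n} → Permutation′ n → Set
IsDerangement σ = ∀ i → σ ⟨$⟩ʳ i ≢ i

isDerangement? : ∀ {n} → Decidable (IsDerangement {n})
isDerangement? σ = all? λ i → ¬? (σ ⟨$⟩ʳ i ≟ i)

𝔇 : ∀ n → List (Permutation′ n)
𝔇 n = filter isDerangement? (permutations n)

infixr 8 _^^_

_^^_ : ∀ {n} → Permutation′ n → ℕ → Fin n → Fin n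
(σ ^^ k) i = fold i (σ ⟨$⟩ʳ_) k

SameCycle : ∀ {n} → Permutation′ n → Fin n → Fin n → Set
SameCycle σ i j = ∃ λ k → (σ ^^ k) i ≡ j

private
  -- By the pigeonhole principle an exponent k ≥ n can be lowered.
  bounded : ∀ {n} (σ : Permutation′ n) {i j} k → (σ ^^ k) i ≡ j →
            ∃ λ m → m ℕ.< n × (σ ^^ m) i ≡ j
  bounded {n} σ {i} {j} = <-rec _ go
    where
    go : ∀ k → (∀ {l} → l ℕ.< k → (σ ^^ l) i ≡ j → ∃ λ m → m ℕ.< n × (σ ^^ m) i ≡ j) →
         (σ ^^ k) i ≡ j → ∃ λ m → m ℕ.< n × (σ ^^ m) i ≡ j
    go k rec eq with k ℕₚ.<? n
    ... | yes k<n = k , k<n , eq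
    ... | no  k≮n
      with a , b , a<b , eqab ← pigeonhole (ℕₚ.n<1+n n) (λ l → (σ ^^ toℕ l) i) =
        rec {k ℕ.∸ toℕ b ℕ.+ toℕ a} shorter (begin
          (σ ^^ (k ℕ.∸ toℕ b ℕ.+ toℕ a)) i       ≡⟨ fold-+ i _ (k ℕ.∸ toℕ b) ⟩
          (σ ^^ (k ℕ.∸ toℕ b)) ((σ ^^ toℕ a) i)  ≡⟨ cong (σ ^^ (k ℕ.∸ toℕ b)) eqab ⟩
          (σ ^^ (k ℕ.∸ toℕ b)) ((σ ^^ toℕ b) i)  ≡⟨ fold-+ i _ (k ℕ.∸ toℕ b) ⟨
          (σ ^^ (k ℕ.∸ toℕ b ℕ.+ toℕ b)) i       ≡⟨ cong (λ l → (σ ^^ l) i) (ℕₚ.m∸n+n≡m b≤k) ⟩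
          (σ ^^ k) i                             ≡⟨ eq ⟩
          j                                      ∎)
      where
      open ≡-Reasoning
      b≤k : toℕ b ℕ.≤ k
      b≤k = ℕₚ.≤-trans (ℕₚ.≤-pred (toℕ<n b)) (ℕₚ.≮⇒≥ k≮n)
      shorter : k ℕ.∸ toℕ b ℕ.+ toℕ a ℕ.< k
      shorter = subst (k ℕ.∸ toℕ b ℕ.+ toℕ a ℕ.<_) (ℕₚ.m∸n+n≡m b≤k)
                  (ℕₚ.+-monoʳ-< (k ℕ.∸ toℕ b) a<b)

sameCycle? : ∀ {n} (σ : Permutation′ n) i j → Dec (SameCycle σ i j)
sameCycle? {n} σ i j = map′
  (λ (k , _ , eq) → k , eq)
  (λ (k , eq) → bounded σ k eq)
  (ℕₚ.anyUpTo? (λ k → (σ ^^ k) i ≟ j) n)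

-- The number of cycles, fixed points included: one letter is kept per cycle.

cyc : ∀ {n} → Permutation′ n → ℕ
cyc {n} σ = length (deduplicate (sameCycle? σ) (allFin n))

#_ : ∀ {n} {P : Pred (Fin n) 0ℓ} → Decidable P → ℕ
#_ {n} P? = length (filter P? (allFin n))

exc : ∀ {n} → Permutation′ n → ℕ
exc σ = # λ i → i <? (σ ⟨$⟩ʳ i)

-- σ ⟨$⟩ˡ x is σ⁻¹(x) and σ ⟨$⟩ʳ x is σ(x).

cpk : ∀ {n} → Permutation′ n → ℕ
cpk σ = # λ x → ((σ ⟨$⟩ˡ x) <? x) ×-dec ((σ ⟨$⟩ʳ x) <? x)

-- Identities between rational or algebraic functions are read in an arbitrary
-- commutative ring, at elements for which the denominators are invertible.

module GeneratingFunctions {c ℓ} (R : CommutativeRing c ℓ) where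

  open CommutativeRing R hiding (_≈_; refl; sym; trans)
  open CommutativeRing R using () renaming (_≈_ to _≈ᴿ_)
  open Exp semiring using (_^_) public

  IsUnit : Carrier → Set _
  IsUnit = AlgDefs.Invertible _≈ᴿ_ 1# _*_

  infixl 7 _/_

  _/_ : (a b : Carrier) → ⦃ IsUnit b ⦄ → Carrier
  (a / b) ⦃ b⁻¹ , _ ⦄ = a * b⁻¹

  2# 4# : Carrier
  2# = 1# + 1#
  4# = 2# + 2#

  -- P stats Ω ts is the sum over σ in Ω of the product over j of tⱼ ^ statⱼ σ.

  P : ∀ {n m} → Vec (Permutation′ n → ℕ) m → List (Permutation′ n) →
      Vec Carrier m → Carrier
  P stats Ω ts =
    foldr _+_ 0# (map (λ σ → Vec.foldr′ _*_ 1# (Vec.zipWith (λ stat t → t ^ stat σ) stats ts)) Ω)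

  D : ℕ → Carrier → Carrier → Carrier
  D n q t = P (cyc Vec.∷ exc Vec.∷ Vec.[]) (𝔇 n) (q Vec.∷ t Vec.∷ Vec.[])

  discriminant : Carrier → Carrier → Carrier
  discriminant x t = (1# + t) ^ 2 - 4# * x * t

  -- In 𝑢 and 𝑣 the argument s stands for √((1 + t)² - 4xt).

  𝑢 : (x t s : Carrier) → ⦃ IsUnit (2# * (1# - x) * t) ⦄ → Carrier
  𝑢 x t s = (1# + t ^ 2 - 2# * x * t - (1# - t) * s) / (2# * (1# - x) * t)

  𝑣 : (x t s : Carrier) → ⦃ IsUnit (2# * x * t) ⦄ → Carrier
  𝑣 x t s = ((1# + t) ^ 2 - 2# * x * t - (1# + t) * s) / (2# * x * t)

{-# OPTIONS --safe #-}
module Submission where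

-- Weight each letter of a permutation according to whether it is a cyclic peak,
-- valley, double ascent, double descent or fixed point, and each cycle by q.
-- Inserting a new least letter into a cycle creates a valley and changes the
-- kind of exactly one other letter, so the weighted sums F n over all
-- permutations of n letters satisfy
--   F (n + 1) = q · fixed · F n + ∂ (F n)
-- for the derivation
--   peak ↦ 0,  valley ↦ valley · (ascent + descent),
--   ascent, descent, fixed ↦ peak · valley.
-- Here ∂ (F n) is the ε-part of F n at the weights w + ε ∂ w over the dual
-- numbers R[ε]. As w ↦ w + ε ∂ w respects equality of peak · valley, of
-- ascent + descent and of fixed, induction on n over all rings at once shows
-- that F n depends on these three quantities only. Each of the two identities
-- compares two weights on which they agree, with fixed = 0 to discard the
-- permutations that are not derangements.

open import Defs
open import Algebra.Bundles using (AbelianGroup; CommutativeRing; RawRing)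
import Algebra.Construct.DirectProduct as DirectProduct
import Algebra.Properties.AbelianGroup as AbelianGroupProperties
import Algebra.Properties.CommutativeMonoid.Sum as Sum
import Algebra.Properties.Ring as RingProperties
import Algebra.Properties.Semiring.Exp as Exp
import Algebra.Properties.Semiring.Mult.TCOptimised as Mult
import Algebra.Properties.Semiring.Sum as SemiringSum
import Algebra.Solver.Ring as RingSolver
open import Algebra.Solver.Ring.AlmostCommutativeRing using (_-Raw-AlmostCommutative⟶_; fromCommutativeRing)
import Algebra.Solver.Ring.NaturalCoefficients.Default as SemiringSolver
open import Data.Bool.Base using (Bool; true; false; if_then_else_; _∧_)
open import Data.Fin.Base using (Fin; zero; suc; toℕ)
open import Data.Fin.Permutation using (Permutation′; _⟨$⟩ʳ_; _⟨$⟩ˡ_; inverseˡ; inverseʳ)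
open import Data.Fin.Properties using (_≟_; _<?_; pigeonhole; suc-injective; ¬∀⟶∃¬)
open import Data.List.Base
  using (List; []; _∷_; _++_; length; filter; foldr; map; allFin; tabulate; deduplicate; cartesianProductWith)
open import Data.List.Membership.Propositional.Properties using (∈-allFin)
open import Data.List.Properties using (map-tabulate; filter-all; length-map)
open import Data.List.Relation.Unary.All as All using (_∷_)
import Data.List.Relation.Unary.All.Properties as Allₚ
open import Data.List.Relation.Unary.AllPairs using (AllPairs; []; _∷_)
import Data.List.Relation.Unary.AllPairs.Properties as AllPairsₚ
open import Data.List.Relation.Unary.Any as Any using (Any; here; there)
import Data.List.Relation.Unary.Any.Properties as Anyₚ
open import Data.Maybe.Base using (Maybe; just; nothing)
open import Data.Nat.Base as ℕ using (ℕ; zero; suc; _≥_)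
open import Data.Nat.GeneralisedArithmetic using (fold-+)
import Data.Nat.Properties as ℕₚ
open import Data.Product.Base using (_×_; _,_; proj₁; proj₂)
open import Data.Vec.Base using ([]; _∷_)
open import Function.Base using (id; _∘_)
open import Level using (0ℓ)
open import Relation.Binary.Core using (Rel)
import Relation.Binary.Definitions as B
open import Relation.Binary.PropositionalEquality as ≡ using (_≡_; _≢_; cong; cong₂)
import Relation.Binary.Reasoning.Setoid as SetoidReasoning
open import Relation.Nullary.Decidable
  using (yes; no; does; ¬?; _×-dec_; dec-true; dec-false; decidable-stable)
open import Relation.Nullary.Negation using (¬_; contradiction)
open import Relation.Unary using (Pred; Decidable)

-- Cycles under insertion of a least letter

module _ {a b p r} {A : Set a} {B : Set b} {R : Rel A p} {S : Rel B r}
         (R? : B.Decidable R) (S? : B.Decidable S) (f : A → B)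
         (preserves : ∀ {x y} → R x y → S (f x) (f y))
         (reflects  : ∀ {x y} → S (f x) (f y) → R x y) where

  filter-map-embedding : ∀ x ys → filter (¬? ∘ S? (f x)) (map f ys) ≡ map f (filter (¬? ∘ R? x) ys)
  filter-map-embedding x []       = ≡.refl
  filter-map-embedding x (y ∷ ys) with R? x y | S? (f x) (f y)
  ... | yes _ | yes _ = filter-map-embedding x ys
  ... | no  _ | no  _ = cong (f y ∷_) (filter-map-embedding x ys)
  ... | yes r | no ¬s = contradiction (preserves r) ¬s
  ... | no ¬r | yes s = contradiction (reflects s) ¬r

  -- `deduplicate` consults only the relation, so it commutes with a map that preserves and reflects
  -- it. Used with `suc`, it carries the cycle representatives of `π` over to the extended
  -- permutation.
  deduplicate-map-embedding : ∀ xs → deduplicate S? (map f xs) ≡ map f (deduplicate R? xs)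
  deduplicate-map-embedding []       = ≡.refl
  deduplicate-map-embedding (x ∷ xs) = cong (f x ∷_) (≡.trans
    (cong (filter (¬? ∘ S? (f x))) (deduplicate-map-embedding xs))
    (filter-map-embedding x (deduplicate R? xs)))

module _ {a p} {A : Set a} {R : Rel A p} (R? : B.Decidable R) where

  deduplicate-pairwise : ∀ xs → AllPairs (λ x y → ¬ R x y) (deduplicate R? xs)
  deduplicate-pairwise []       = []
  deduplicate-pairwise (x ∷ xs) =
    Allₚ.all-filter (¬? ∘ R? x) (deduplicate R? xs) ∷
    AllPairsₚ.filter⁺ (¬? ∘ R? x) (deduplicate-pairwise xs)

module _ {a p q} {A : Set a} {P : Pred A p} {R : Rel A q} (P? : Decidable P)
         (related : ∀ {x y} → P x → P y → R x y) where

  -- At most one element of a pairwise unrelated list has `P`, since two such would be related, and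
  -- `Any P` supplies one; the filter drops exactly that one.
  length-filter-representative : ∀ {xs} → AllPairs (λ x y → ¬ R x y) xs → Any P xs →
                                 suc (length (filter (¬? ∘ P?) xs)) ≡ length xs
  length-filter-representative {x ∷ xs} (¬Rx ∷ ¬R) any with P? x | any
  ... | yes px | _ = cong (suc ∘ length) (filter-all (¬? ∘ P?) (All.map (λ ¬r py → ¬r (related px py)) ¬Rx))
  ... | no _   | there pxs = cong suc (length-filter-representative ¬R pxs)
  ... | no ¬px | here px = contradiction px ¬px

allFin-suc : ∀ n → allFin (suc n) ≡ zero ∷ map suc (allFin n)
allFin-suc n = cong (zero ∷_) (≡.sym (map-tabulate id suc))

-- Lying on the same cycle as an equivalence relation.

module _ {n} (σ : Permutation′ n) where

  perm-injective : ∀ {x y} → σ ⟨$⟩ʳ x ≡ σ ⟨$⟩ʳ y → x ≡ y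
  perm-injective eq = ≡.trans (≡.sym (inverseˡ σ)) (≡.trans (cong (σ ⟨$⟩ˡ_) eq) (inverseˡ σ))

  sameCycle-refl : ∀ {i} → SameCycle σ i i
  sameCycle-refl = 0 , ≡.refl

  sameCycle-step : ∀ i → SameCycle σ i (σ ⟨$⟩ʳ i)
  sameCycle-step i = 1 , ≡.refl

  sameCycle-trans : ∀ {i j k} → SameCycle σ i j → SameCycle σ j k → SameCycle σ i k
  sameCycle-trans {i} (l , ≡.refl) (m , eq) = m ℕ.+ l , ≡.trans (fold-+ i (σ ⟨$⟩ʳ_) m) eq

  ^^-injective : ∀ k {i j} → (σ ^^ k) i ≡ (σ ^^ k) j → i ≡ j
  ^^-injective zero    eq = eq
  ^^-injective (suc k) eq = ^^-injective k (perm-injective eq)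

  -- Two of the powers 0, ..., n agree at `i`; cancelling the smaller one shows that `i` returns to
  -- itself after `k + 1` steps, the last `k` of which start at `σ ⟨$⟩ʳ i`.
  sameCycle-unstep : ∀ i → SameCycle σ (σ ⟨$⟩ʳ i) i
  sameCycle-unstep i
    with a , b , a<b , eq ← pigeonhole (ℕₚ.n<1+n n) (λ l → (σ ^^ toℕ l) i)
    with k , a+k≡b ← ℕₚ.m≤n⇒∃[o]m+o≡n a<b = k , ≡.sym (^^-injective (toℕ a) (begin
    (σ ^^ toℕ a) i                        ≡⟨ eq ⟩
    (σ ^^ toℕ b) i                        ≡⟨ cong (λ l → (σ ^^ l) i) a+[k+1]≡b ⟨
    (σ ^^ (toℕ a ℕ.+ (k ℕ.+ 1))) i        ≡⟨ fold-+ i (σ ⟨$⟩ʳ_) (toℕ a) ⟩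
    (σ ^^ toℕ a) ((σ ^^ (k ℕ.+ 1)) i)     ≡⟨ cong (σ ^^ toℕ a) (fold-+ i (σ ⟨$⟩ʳ_) k) ⟩
    (σ ^^ toℕ a) ((σ ^^ k) (σ ⟨$⟩ʳ i))    ∎))
    where
    open ≡.≡-Reasoning
    a+[k+1]≡b : toℕ a ℕ.+ (k ℕ.+ 1) ≡ toℕ b
    a+[k+1]≡b = ≡.trans (cong (toℕ a ℕ.+_) (ℕₚ.+-comm k 1)) (≡.trans (ℕₚ.+-suc (toℕ a) k) a+k≡b)

  sameCycle-sym : ∀ {i j} → SameCycle σ i j → SameCycle σ j i
  sameCycle-sym (zero  , ≡.refl) = sameCycle-refl
  sameCycle-sym (suc k , ≡.refl) = sameCycle-trans (sameCycle-unstep _) (sameCycle-sym (k , ≡.refl))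

module _ {n} (π : Permutation′ n) where

  extend-zero-^^ : ∀ k i → (extend zero π ^^ k) (suc i) ≡ suc ((π ^^ k) i)
  extend-zero-^^ zero    i = ≡.refl
  extend-zero-^^ (suc k) i = cong (extend zero π ⟨$⟩ʳ_) (extend-zero-^^ k i)

  extend-zero-fixes : ∀ k → (extend zero π ^^ k) zero ≡ zero
  extend-zero-fixes zero    = ≡.refl
  extend-zero-fixes (suc k) = cong (extend zero π ⟨$⟩ʳ_) (extend-zero-fixes k)

  cyc-extend-zero : cyc (extend zero π) ≡ suc (cyc π)
  cyc-extend-zero = begin
    length (deduplicate S? (allFin (suc n)))
      ≡⟨ cong (length ∘ deduplicate S?) (allFin-suc n) ⟩
    suc (length (filter (¬? ∘ S? zero) (deduplicate S? (map suc (allFin n)))))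
      ≡⟨ cong (suc ∘ length) (filter-all (¬? ∘ S? zero)
           (Allₚ.deduplicate⁺ S? (Allₚ.map⁺ (All.universal zero≁suc (allFin n))))) ⟩
    suc (length (deduplicate S? (map suc (allFin n))))
      ≡⟨ cong (suc ∘ length) (deduplicate-map-embedding (sameCycle? π) S? suc preserves reflects (allFin n)) ⟩
    suc (length (map Fin.suc (deduplicate (sameCycle? π) (allFin n))))
      ≡⟨ cong suc (length-map Fin.suc (deduplicate (sameCycle? π) (allFin n))) ⟩
    suc (cyc π) ∎
    where
    open ≡.≡-Reasoning
    S? = sameCycle? (extend zero π)
    zero≁suc : ∀ i → ¬ SameCycle (extend zero π) zero (suc i)
    zero≁suc i (k , eq) with () ← ≡.trans (≡.sym (extend-zero-fixes k)) eq
    preserves : ∀ {i j} → SameCycle π i j → SameCycle (extend zero π) (suc i) (suc j)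
    preserves (k , ≡.refl) = k , extend-zero-^^ k _
    reflects : ∀ {i j} → SameCycle (extend zero π) (suc i) (suc j) → SameCycle π i j
    reflects (k , eq) = k , suc-injective (≡.trans (≡.sym (extend-zero-^^ k _)) eq)

module _ {n} (j : Fin n) (π : Permutation′ n) where

  -- Following `lift₀ π` by the transposition redirects the arrow into `j`: the letter before `j`
  -- now goes to `zero`, and `zero` goes to `j`.
  extend-suc-hit : ∀ {i} → π ⟨$⟩ʳ i ≡ j → extend (suc j) π ⟨$⟩ʳ suc i ≡ zero
  extend-suc-hit {i} eq rewrite dec-true (π ⟨$⟩ʳ i ≟ j) eq = ≡.refl

  extend-suc-miss : ∀ {i} → π ⟨$⟩ʳ i ≢ j → extend (suc j) π ⟨$⟩ʳ suc i ≡ suc (π ⟨$⟩ʳ i)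
  extend-suc-miss {i} neq rewrite dec-false (π ⟨$⟩ʳ i ≟ j) neq = ≡.refl

  -- The inserted letter zero is identified with its successor j: this turns
  -- every step of the extended permutation into at most one step of π.

  contract : Fin (suc n) → Fin n
  contract zero    = j
  contract (suc i) = i

  sameCycle-contract-step : ∀ y → SameCycle π (contract y) (contract (extend (suc j) π ⟨$⟩ʳ y))
  sameCycle-contract-step zero    = sameCycle-refl π
  sameCycle-contract-step (suc i) with π ⟨$⟩ʳ i ≟ j
  ... | yes eq  = 1 , eq
  ... | no  neq = sameCycle-step π i

  sameCycle-contract : ∀ {y z} → SameCycle (extend (suc j) π) y z → SameCycle π (contract y) (contract z)
  sameCycle-contract (zero  , ≡.refl) = sameCycle-refl π
  sameCycle-contract {y} (suc k , ≡.refl) =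
    sameCycle-trans π (sameCycle-contract {y} (k , ≡.refl)) (sameCycle-contract-step ((extend (suc j) π ^^ k) y))

  sameCycle-extend-step : ∀ i → SameCycle (extend (suc j) π) (suc i) (suc (π ⟨$⟩ʳ i))
  sameCycle-extend-step i with π ⟨$⟩ʳ i ≟ j
  -- The arrow from `i` to `j` now passes through `zero`, hence two steps.
  ... | yes eq  = 2 , ≡.trans (cong (extend (suc j) π ⟨$⟩ʳ_) (extend-suc-hit eq)) (cong suc (≡.sym eq))
  ... | no  neq = 1 , extend-suc-miss neq

  sameCycle-extend : ∀ {i k} → SameCycle π i k → SameCycle (extend (suc j) π) (suc i) (suc k)
  sameCycle-extend (zero  , ≡.refl) = sameCycle-refl (extend (suc j) π)
  sameCycle-extend (suc m , ≡.refl) =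
    sameCycle-trans (extend (suc j) π) (sameCycle-extend (m , ≡.refl)) (sameCycle-extend-step _)

  -- `zero` joins the cycle of `j`. Coming first in the list, it represents that cycle and displaces
  -- the representative chosen in `π`, so the count is unchanged.
  cyc-extend-suc : cyc (extend (suc j) π) ≡ cyc π
  cyc-extend-suc = begin
    length (deduplicate S? (allFin (suc n)))
      ≡⟨ cong (length ∘ deduplicate S?) (allFin-suc n) ⟩
    suc (length (filter (¬? ∘ S? zero) (deduplicate S? (map suc (allFin n)))))
      ≡⟨ cong (λ l → suc (length (filter (¬? ∘ S? zero) l)))
           (deduplicate-map-embedding (sameCycle? π) S? suc sameCycle-extend sameCycle-contract (allFin n)) ⟩
    suc (length (filter (¬? ∘ S? zero) (map suc representatives)))
      ≡⟨ length-filter-representative {R = λ y z → SameCycle π (contract y) (contract z)} (S? zero)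
           (λ p q → sameCycle-trans π (sameCycle-sym π (sameCycle-contract p)) (sameCycle-contract q))
           {xs = map suc representatives}
           (AllPairsₚ.map⁺ (deduplicate-pairwise (sameCycle? π) (allFin n)))
           (Anyₚ.map⁺ (Any.map (sameCycle-trans (extend (suc j) π) (1 , ≡.refl) ∘ sameCycle-extend)
             (Anyₚ.deduplicate⁺ (sameCycle? π) {xs = allFin n}
               (λ r p → sameCycle-trans π p (sameCycle-sym π r))
               (Any.map (λ { ≡.refl → sameCycle-refl π }) (∈-allFin j))))) ⟩
    length (map suc representatives)
      ≡⟨ length-map suc representatives ⟩
    cyc π ∎
    where
    open ≡.≡-Reasoning
    S? = sameCycle? (extend (suc j) π)
    representatives = deduplicate (sameCycle? π) (allFin n)

-- R[ε] with ε² = 0; the pair (a , b) stands for a + ε b.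

dualNumbers : ∀ {c ℓ} → CommutativeRing c ℓ → CommutativeRing c ℓ
dualNumbers R = record
  { _≈_ = R×R._≈_
  ; _+_ = R×R._∙_
  ; _*_ = λ (a , b) (c , d) → a * c , a * d + b * c
  ; -_  = R×R._⁻¹
  ; 0#  = R×R.ε
  ; 1#  = 1# , 0#
  ; isCommutativeRing = record
    { isRing = record
      { +-isAbelianGroup = R×R.isAbelianGroup
      ; *-cong = λ (p , p′) (q , q′) → *-cong p q , +-cong (*-cong p q′) (*-cong p′ q)
      ; *-assoc = λ (a , a′) (b , b′) (c , c′) →
          *-assoc a b c ,
          solve 6 (λ a a′ b b′ c c′ →
            (a :* b) :* c′ :+ (a :* b′ :+ a′ :* b) :* c :=
            a :* (b :* c′ :+ b′ :* c) :+ a′ :* (b :* c)) refl a a′ b b′ c c′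
      ; *-identity =
          (λ (a , a′) → *-identityˡ a ,
            solve 2 (λ a a′ → con 1 :* a′ :+ con 0 :* a := a′) refl a a′) ,
          (λ (a , a′) → *-identityʳ a ,
            solve 2 (λ a a′ → a :* con 0 :+ a′ :* con 1 := a′) refl a a′)
      ; distrib =
          (λ (a , a′) (b , b′) (c , c′) → distribˡ a b c ,
            solve 6 (λ a a′ b b′ c c′ →
              a :* (b′ :+ c′) :+ a′ :* (b :+ c) :=
              (a :* b′ :+ a′ :* b) :+ (a :* c′ :+ a′ :* c)) refl a a′ b b′ c c′) ,
          (λ (a , a′) (b , b′) (c , c′) → distribʳ a b c ,
            solve 6 (λ a a′ b b′ c c′ →
              (b :+ c) :* a′ :+ (b′ :+ c′) :* a :=
              (b :* a′ :+ b′ :* a) :+ (c :* a′ :+ c′ :* a)) refl a a′ b b′ c c′)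
      }
    ; *-comm = λ (a , a′) (b , b′) → *-comm a b ,
        solve 4 (λ a a′ b b′ → a :* b′ :+ a′ :* b := b :* a′ :+ b′ :* a) refl a a′ b b′
    }
  }
  where
  open CommutativeRing R
  open SemiringSolver commutativeSemiring
  module R×R = AbelianGroup (DirectProduct.abelianGroup +-abelianGroup +-abelianGroup)

-- The enumerator of permutations by weighted letters

data Direction : Set where
  up flat down : Direction

-- Defined by recursion so that shifting both letters by `suc` leaves the direction unchanged
-- definitionally, and an arrow to or from a new least letter has its direction at once.
direction : ∀ {n} → Fin n → Fin n → Direction
direction zero    zero    = flat
direction zero    (suc j) = up
direction (suc i) zero    = down
direction (suc i) (suc j) = direction i j

direction-refl : ∀ {n} (i : Fin n) → direction i i ≡ flat
direction-refl zero    = ≡.refl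
direction-refl (suc i) = direction-refl i

direction-flat : ∀ {n} (i j : Fin n) → direction i j ≡ flat → i ≡ j
direction-flat zero    zero    eq = ≡.refl
direction-flat (suc i) (suc j) eq = cong suc (direction-flat i j eq)

incoming outgoing : ∀ {n} → Permutation′ n → Fin n → Direction
incoming σ x = direction (σ ⟨$⟩ˡ x) x
outgoing σ x = direction x (σ ⟨$⟩ʳ x)

module _ {n} (π : Permutation′ n) where

  incoming-image : ∀ i → incoming π (π ⟨$⟩ʳ i) ≡ outgoing π i
  incoming-image i = cong (λ l → direction l (π ⟨$⟩ʳ i)) (inverseˡ π)

  module _ (i : Fin n) where

    private
      j  = π ⟨$⟩ʳ i
      π⁺ = extend (suc j) π

    incoming-extend-hit : incoming π⁺ (suc j) ≡ up
    incoming-extend-hit rewrite dec-true (j ≟ j) ≡.refl = ≡.refl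

    incoming-extend-miss : ∀ {x} → x ≢ j → incoming π⁺ (suc x) ≡ incoming π x
    incoming-extend-miss {x} x≢j rewrite dec-false (x ≟ j) x≢j = ≡.refl

    outgoing-extend-hit : outgoing π⁺ (suc i) ≡ down
    outgoing-extend-hit rewrite dec-true (j ≟ j) ≡.refl = ≡.refl

    outgoing-extend-miss : ∀ {x} → x ≢ i → outgoing π⁺ (suc x) ≡ outgoing π x
    outgoing-extend-miss {x} x≢i
      rewrite dec-false (π ⟨$⟩ʳ x ≟ j) (x≢i ∘ perm-injective π) = ≡.refl

    -- The arrow into `j` now starts at the least letter and ascends; if the replaced arrow already
    -- did, no incoming side changes. `outgoing-extend-down` is the mirror image for the arrow
    -- leaving `i`.
    incoming-extend-up : outgoing π i ≡ up → ∀ x → incoming π⁺ (suc x) ≡ incoming π x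
    incoming-extend-up out x with x ≟ j
    ... | yes ≡.refl = ≡.sym (≡.trans (incoming-image i) out)
    ... | no  x≢j    = ≡.refl

    outgoing-extend-down : outgoing π i ≡ down → ∀ x → outgoing π⁺ (suc x) ≡ outgoing π x
    outgoing-extend-down out x with x ≟ i
    ... | yes ≡.refl = ≡.trans outgoing-extend-hit (≡.sym out)
    ... | no  x≢i    = outgoing-extend-miss x≢i

module Enumerator {c ℓ} (R : CommutativeRing c ℓ) where

  open CommutativeRing R hiding (zero)
  open SemiringSum semiring public using (sum; sum-cong-≋; ∑-distrib-+; *-distribˡ-sum; ∑-permute)
  open Sum *-commutativeMonoid public using () renaming (sum to product; sum-cong-≋ to product-cong)
  open Exp semiring using (_^_; ^-congʳ)
  open SemiringSolver commutativeSemiring using (solve; _:+_; _:*_; _:=_; con)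
  open SetoidReasoning setoid

  -- Sums over lists and products over letters.

  listSum : ∀ {a} {A : Set a} → (A → Carrier) → List A → Carrier
  listSum f xs = foldr _+_ 0# (map f xs)

  listSum-cong : ∀ {a} {A : Set a} {f g : A → Carrier} → (∀ x → f x ≈ g x) → ∀ xs → listSum f xs ≈ listSum g xs
  listSum-cong f≈g []       = refl
  listSum-cong f≈g (x ∷ xs) = +-cong (f≈g x) (listSum-cong f≈g xs)

  listSum-++ : ∀ {a} {A : Set a} (f : A → Carrier) xs ys → listSum f (xs ++ ys) ≈ listSum f xs + listSum f ys
  listSum-++ f []       ys = sym (+-identityˡ _)
  listSum-++ f (x ∷ xs) ys = trans (+-congˡ (listSum-++ f xs ys)) (sym (+-assoc _ _ _))

  listSum-+ : ∀ {a} {A : Set a} (f g : A → Carrier) xs → listSum (λ x → f x + g x) xs ≈ listSum f xs + listSum g xs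
  listSum-+ f g []       = sym (+-identityˡ _)
  listSum-+ f g (x ∷ xs) = trans (+-congˡ (listSum-+ f g xs))
    (solve 4 (λ a b c d → (a :+ b) :+ (c :+ d) := (a :+ c) :+ (b :+ d)) refl _ _ _ _)

  *-distribˡ-listSum : ∀ {a} {A : Set a} k (f : A → Carrier) xs → k * listSum f xs ≈ listSum (λ x → k * f x) xs
  *-distribˡ-listSum k f []       = zeroʳ k
  *-distribˡ-listSum k f (x ∷ xs) = trans (distribˡ k _ _) (+-congˡ (*-distribˡ-listSum k f xs))

  -- The sum over the second list is moved outside: `permutations` runs through `j` first, while the
  -- recurrence needs all `j` for a given `π`.
  listSum-cartesianProductWith : ∀ {a b d} {A : Set a} {B : Set b} {D : Set d} (g : D → Carrier) (f : A → B → D) xs ys →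
    listSum g (cartesianProductWith f xs ys) ≈ listSum (λ y → listSum (λ x → g (f x y)) xs) ys
  listSum-cartesianProductWith g f []       ys = sym (zeros ys)
    where
    zeros : ∀ {b} {B : Set b} (ys : List B) → listSum (λ _ → 0#) ys ≈ 0#
    zeros []       = refl
    zeros (y ∷ ys) = trans (+-identityˡ _) (zeros ys)
  listSum-cartesianProductWith g f (x ∷ xs) ys = begin
    listSum g (map (f x) ys ++ cartesianProductWith f xs ys)
      ≈⟨ listSum-++ g (map (f x) ys) _ ⟩
    listSum g (map (f x) ys) + listSum g (cartesianProductWith f xs ys)
      ≈⟨ +-cong (listSum-map ys) (listSum-cartesianProductWith g f xs ys) ⟩
    listSum (λ y → g (f x y)) ys + listSum (λ y → listSum (λ x → g (f x y)) xs) ys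
      ≈⟨ listSum-+ _ _ ys ⟨
    listSum (λ y → listSum (λ x → g (f x y)) (x ∷ xs)) ys ∎
    where
    listSum-map : ∀ ys → listSum g (map (f x) ys) ≈ listSum (λ y → g (f x y)) ys
    listSum-map []       = refl
    listSum-map (y ∷ ys) = +-congˡ (listSum-map ys)

  listSum-tabulate : ∀ {a} {A : Set a} {n} (g : A → Carrier) (f : Fin n → A) → listSum g (tabulate f) ≡ sum (g ∘ f)
  listSum-tabulate {n = zero}  g f = ≡.refl
  listSum-tabulate {n = suc n} g f = cong (g (f zero) +_) (listSum-tabulate g (f ∘ suc))

  -- The cofactor of `x`, obtained without division so that `f x` may be any ring element.
  product-others : ∀ {n} → (Fin n → Carrier) → Fin n → Carrier
  product-others f zero    = product (f ∘ suc)
  product-others f (suc x) = f zero * product-others (f ∘ suc) x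

  product-replace : ∀ {n} {f g : Fin n → Carrier} x → (∀ y → y ≢ x → g y ≈ f y) →
                    product g ≈ g x * product-others f x
  product-replace zero    g≈f = *-congˡ (product-cong (λ y → g≈f (suc y) λ ()))
  product-replace {f = f} {g} (suc x) g≈f = begin
    g zero * product (g ∘ suc)
      ≈⟨ *-cong (g≈f zero λ ()) (product-replace x (λ y y≢x → g≈f (suc y) (y≢x ∘ suc-injective))) ⟩
    f zero * (g (suc x) * product-others (f ∘ suc) x)
      ≈⟨ solve 3 (λ a b c → a :* (b :* c) := b :* (a :* c)) refl _ _ _ ⟩
    g (suc x) * (f zero * product-others (f ∘ suc) x) ∎

  -- Letter weights and the derivation.

  record Weights : Set c where
    constructor weights
    field peak valley ascent descent fixed : Carrier

  open Weights public

  -- The last clause never applies to a letter of a permutation, since only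
  -- fixed points have a flat side.

  weight : Weights → Direction → Direction → Carrier
  weight w up   up   = ascent w
  weight w up   down = peak w
  weight w down up   = valley w
  weight w down down = descent w
  weight w flat flat = fixed w
  weight w _    _    = 0#

  letterWeight : ∀ {n} → Weights → Permutation′ n → Fin n → Carrier
  letterWeight w σ x = weight w (incoming σ x) (outgoing σ x)

  permutationWeight : ∀ {n} → Carrier → Weights → Permutation′ n → Carrier
  permutationWeight q w σ = q ^ cyc σ * product (letterWeight w σ)

  enumerator : ℕ → Carrier → Weights → Carrier
  enumerator n q w = listSum (permutationWeight q w) (permutations n)

  ∂ : Weights → Weights
  ∂ w = weights 0# (valley w * (ascent w + descent w))
                (peak w * valley w) (peak w * valley w) (peak w * valley w)

  -- Inserting a new least letter after i and before j = π i makes the outgoing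
  -- side of i a descent and the incoming side of j an ascent. Exactly one of
  -- the two letters changes kind, according to the direction from i to j.

  changedOutgoing changedIncoming : Weights → Direction → Direction → Carrier
  changedOutgoing w d up   = weight w d down
  changedOutgoing w d flat = 0#
  changedOutgoing w d down = 0#
  changedIncoming w up   e = 0#
  changedIncoming w flat flat = peak w
  changedIncoming w flat e = 0#
  changedIncoming w down e = weight w up e

  -- `valley w` is the weight of the inserted letter. A valley can change on either side, whence
  -- `ascent w + descent w`; an ascent, a descent or a fixed point can only become a peak; a peak
  -- never changes. Both sides of a fixed point are replaced at once, so it is charged to its
  -- incoming side alone.
  ∂-changed : ∀ w d e → valley w * (changedOutgoing w d e + changedIncoming w d e) ≈ weight (∂ w) d e
  ∂-changed w up   up   = solve 2 (λ p v → v :* (p :+ con 0) := p :* v) refl _ _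
  ∂-changed w up   flat = solve 1 (λ v → v :* (con 0 :+ con 0) := con 0) refl _
  ∂-changed w up   down = solve 1 (λ v → v :* (con 0 :+ con 0) := con 0) refl _
  ∂-changed w flat up   = solve 1 (λ v → v :* (con 0 :+ con 0) := con 0) refl _
  ∂-changed w flat flat = solve 2 (λ p v → v :* (con 0 :+ p) := p :* v) refl _ _
  ∂-changed w flat down = solve 1 (λ v → v :* (con 0 :+ con 0) := con 0) refl _
  ∂-changed w down up   = *-congˡ (+-comm _ _)
  ∂-changed w down flat = solve 1 (λ v → v :* (con 0 :+ con 0) := con 0) refl _
  ∂-changed w down down = solve 2 (λ p v → v :* (con 0 :+ p) := p :* v) refl _ _

  module _ (w : Weights) {n} (π : Permutation′ n) where

    private
      others : Fin n → Carrier
      others = product-others (letterWeight w π)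
      changedOut changedIn : Fin n → Carrier
      changedOut x = changedOutgoing w (incoming π x) (outgoing π x) * others x
      changedIn  x = changedIncoming w (incoming π x) (outgoing π x) * others x

    -- An ascending arrow leaves the incoming side of `j` ascending, so only `i` changes; a
    -- descending one changes only `j`; a flat one means that `i` is `j`, and this letter becomes a
    -- peak. The other summand is zero.
    product-inserted : ∀ i → let j = π ⟨$⟩ʳ i in
      product (λ x → letterWeight w (extend (suc j) π) (suc x)) ≈ changedOut i + changedIn j
    product-inserted i with outgoing π i in out
    ... | up = begin
      product (λ x → letterWeight w (extend (suc j) π) (suc x))
        ≈⟨ product-replace i (λ y y≢i → reflexive (cong₂ (weight w)
             (incoming-extend-up π i out _) (outgoing-extend-miss π i y≢i))) ⟩
      letterWeight w (extend (suc j) π) (suc i) * others i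
        ≡⟨ cong (_* others i) (cong₂ (weight w)
             (incoming-extend-up π i out i) (outgoing-extend-hit π i)) ⟩
      weight w (incoming π i) down * others i
        ≈⟨ trans (+-congˡ (zeroˡ _)) (+-identityʳ _) ⟨
      weight w (incoming π i) down * others i + 0# * others j
        -- The arrow leaving `i` is the arrow entering `j`, so `incoming π j` is `up` and
        -- `changedIncoming` vanishes.
        ≡⟨ cong (λ d → weight w (incoming π i) down * others i + changedIncoming w d (outgoing π j) * others j)
             (≡.trans (incoming-image π i) out) ⟨
      weight w (incoming π i) down * others i + changedIn j ∎
      where j = π ⟨$⟩ʳ i
    ... | down = begin
      product (λ x → letterWeight w (extend (suc j) π) (suc x))
        ≈⟨ product-replace j (λ y y≢j → reflexive (cong₂ (weight w)
             (incoming-extend-miss π i y≢j) (outgoing-extend-down π i out _))) ⟩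
      letterWeight w (extend (suc j) π) (suc j) * others j
        ≡⟨ cong (_* others j) (cong₂ (weight w)
             (incoming-extend-hit π i) (outgoing-extend-down π i out j)) ⟩
      weight w up (outgoing π j) * others j
        ≈⟨ trans (+-congʳ (zeroˡ _)) (+-identityˡ _) ⟨
      0# * others i + weight w up (outgoing π j) * others j
        ≡⟨ cong (λ d → 0# * others i + changedIncoming w d (outgoing π j) * others j)
             (≡.trans (incoming-image π i) out) ⟨
      0# * others i + changedIn j ∎
      where j = π ⟨$⟩ʳ i
    ... | flat = begin
      product (λ x → letterWeight w (extend (suc j) π) (suc x))
        ≈⟨ product-replace j (λ y y≢j → reflexive (cong₂ (weight w)
             (incoming-extend-miss π i y≢j)
             (outgoing-extend-miss π i (λ y≡i → y≢j (≡.trans y≡i i≡j))))) ⟩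
      letterWeight w (extend (suc j) π) (suc j) * others j
        ≡⟨ cong (_* others j) (cong₂ (weight w) (incoming-extend-hit π i)
             (≡.trans (cong (outgoing (extend (suc j) π) ∘ suc) (≡.sym i≡j)) (outgoing-extend-hit π i))) ⟩
      peak w * others j
        ≈⟨ trans (+-congʳ (zeroˡ _)) (+-identityˡ _) ⟨
      0# * others i + peak w * others j
        ≡⟨ cong₂ (λ d e → 0# * others i + changedIncoming w d e * others j)
             (≡.trans (incoming-image π i) out) (≡.trans (cong (outgoing π) (≡.sym i≡j)) out) ⟨
      0# * others i + changedIn j ∎
      where
      j = π ⟨$⟩ʳ i
      i≡j : i ≡ j
      i≡j = direction-flat i j out

    -- The derivation applied to the product of the letter weights of `π`, by the product rule.
    leibniz : Carrier
    leibniz = sum (λ x → letterWeight (∂ w) π x * others x)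

    sum-product-extend-suc : sum (λ j → product (letterWeight w (extend (suc j) π))) ≈ leibniz
    sum-product-extend-suc = begin
      -- The factor of `zero` is `valley w` by computation: the letters before and after it are
      -- larger.
      sum (λ j → valley w * product (λ x → letterWeight w (extend (suc j) π) (suc x)))
        ≈⟨ ∑-permute _ π ⟩
      sum (λ i → valley w * product (λ x → letterWeight w (extend (suc (π ⟨$⟩ʳ i)) π) (suc x)))
        ≈⟨ sum-cong-≋ (λ i → *-congˡ (product-inserted i)) ⟩
      sum (λ i → valley w * (changedOut i + changedIn (π ⟨$⟩ʳ i)))
        ≈⟨ *-distribˡ-sum (valley w) (λ i → changedOut i + changedIn (π ⟨$⟩ʳ i)) ⟨
      valley w * sum (λ i → changedOut i + changedIn (π ⟨$⟩ʳ i))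
        ≈⟨ *-congˡ (∑-distrib-+ changedOut (changedIn ∘ (π ⟨$⟩ʳ_))) ⟩
      valley w * (sum changedOut + sum (changedIn ∘ (π ⟨$⟩ʳ_)))
        -- Changes of incoming sides are indexed again by the letter that changes, so that each
        -- letter collects both of its own.
        ≈⟨ *-congˡ (+-congˡ (∑-permute changedIn π)) ⟨
      valley w * (sum changedOut + sum changedIn)
        ≈⟨ *-congˡ (∑-distrib-+ changedOut changedIn) ⟨
      valley w * sum (λ x → changedOut x + changedIn x)
        ≈⟨ *-distribˡ-sum (valley w) (λ x → changedOut x + changedIn x) ⟩
      sum (λ x → valley w * (changedOut x + changedIn x))
        ≈⟨ sum-cong-≋ (λ x → trans
             (solve 4 (λ v a b o → v :* (a :* o :+ b :* o) := (v :* (a :+ b)) :* o) refl _ _ _ _)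
             (*-congʳ (∂-changed w (incoming π x) (outgoing π x)))) ⟩
      leibniz ∎

  -- Each permutation of `suc n` letters comes from one `π`: either the least letter is a cycle of
  -- its own, giving `q * fixed w`, or it is inserted into an arrow of `π`, which keeps the number
  -- of cycles.
  enumerator-suc : ∀ n q w → enumerator (suc n) q w ≈
    q * fixed w * enumerator n q w + listSum (λ π → q ^ cyc π * leibniz w π) (permutations n)
  enumerator-suc n q w = begin
    listSum (permutationWeight q w) (cartesianProductWith extend (allFin (suc n)) (permutations n))
      ≈⟨ listSum-cartesianProductWith (permutationWeight q w) extend (allFin (suc n)) (permutations n) ⟩
    listSum (λ π → listSum (λ j → permutationWeight q w (extend j π)) (allFin (suc n))) (permutations n)
      ≈⟨ listSum-cong (λ π → trans
           (reflexive (listSum-tabulate (λ j → permutationWeight q w (extend j π)) id))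
           (+-cong (fixed-letter π) (inserted-letter π))) (permutations n) ⟩
    listSum (λ π → q * fixed w * permutationWeight q w π + q ^ cyc π * leibniz w π) (permutations n)
      ≈⟨ listSum-+ _ _ (permutations n) ⟩
    listSum (λ π → q * fixed w * permutationWeight q w π) (permutations n) +
    listSum (λ π → q ^ cyc π * leibniz w π) (permutations n)
      ≈⟨ +-congʳ (*-distribˡ-listSum (q * fixed w) _ (permutations n)) ⟨
    q * fixed w * enumerator n q w + listSum (λ π → q ^ cyc π * leibniz w π) (permutations n) ∎
    where
    fixed-letter : ∀ π → permutationWeight q w (extend zero π) ≈ q * fixed w * permutationWeight q w π
    fixed-letter π = trans (*-congʳ (^-congʳ q (cyc-extend-zero π)))
      (solve 4 (λ q f a b → (q :* a) :* (f :* b) := (q :* f) :* (a :* b)) refl _ _ _ _)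
    inserted-letter : ∀ π → sum (λ j → permutationWeight q w (extend (suc j) π)) ≈ q ^ cyc π * leibniz w π
    inserted-letter π = begin
      sum (λ j → permutationWeight q w (extend (suc j) π))
        ≈⟨ sum-cong-≋ (λ j → *-congʳ (^-congʳ q (cyc-extend-suc j π))) ⟩
      sum (λ j → q ^ cyc π * product (letterWeight w (extend (suc j) π)))
        ≈⟨ *-distribˡ-sum (q ^ cyc π) (λ j → product (letterWeight w (extend (suc j) π))) ⟨
      q ^ cyc π * sum (λ j → product (letterWeight w (extend (suc j) π)))
        ≈⟨ *-congˡ (sum-product-extend-suc w π) ⟩
      q ^ cyc π * leibniz w π ∎

-- Invariance of the enumerator

module _ {c ℓ} (R : CommutativeRing c ℓ) where

  open CommutativeRing R hiding (zero)
  open Exp semiring using (_^_)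
  open Enumerator R
  private
    module ε  = CommutativeRing (dualNumbers R)
    module εE = Enumerator (dualNumbers R)
    module εX = Exp ε.semiring
  open SemiringSolver commutativeSemiring using (solve; _:+_; _:*_; _:=_; con)

  infix 6 _+ε_

  _+ε_ : Weights → Weights → εE.Weights
  weights p v a d f +ε weights p′ v′ a′ d′ f′ =
    εE.weights (p , p′) (v , v′) (a , a′) (d , d′) (f , f′)

  weight-+ε : ∀ w w′ d e → εE.weight (w +ε w′) d e ≡ (weight w d e , weight w′ d e)
  weight-+ε w w′ up   up   = ≡.refl
  weight-+ε w w′ up   flat = ≡.refl
  weight-+ε w w′ up   down = ≡.refl
  weight-+ε w w′ flat up   = ≡.refl
  weight-+ε w w′ flat flat = ≡.refl
  weight-+ε w w′ flat down = ≡.refl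
  weight-+ε w w′ down up   = ≡.refl
  weight-+ε w w′ down flat = ≡.refl
  weight-+ε w w′ down down = ≡.refl

  -- As ε² = 0, each term of the ε-part takes `g` from exactly one factor: this is the product rule.
  product-ε : ∀ {n} (f g : Fin n → Carrier) →
    εE.product (λ x → f x , g x) ε.≈ (product f , sum (λ x → g x * product-others f x))
  product-ε {zero}  f g = ε.refl
  product-ε {suc n} f g = ε.trans (ε.*-congˡ {f zero , g zero} (product-ε (f ∘ suc) (g ∘ suc))) (refl , (begin
    f zero * sum (λ x → g (suc x) * product-others (f ∘ suc) x) + g zero * product (f ∘ suc)
      ≈⟨ +-comm _ _ ⟩
    g zero * product (f ∘ suc) + f zero * sum (λ x → g (suc x) * product-others (f ∘ suc) x)
      ≈⟨ +-congˡ (*-distribˡ-sum (f zero) (λ x → g (suc x) * product-others (f ∘ suc) x)) ⟩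
    g zero * product (f ∘ suc) + sum (λ x → f zero * (g (suc x) * product-others (f ∘ suc) x))
      ≈⟨ +-congˡ (sum-cong-≋ (λ x → solve 3 (λ a b o → a :* (b :* o) := b :* (a :* o)) refl
           (f zero) (g (suc x)) (product-others (f ∘ suc) x))) ⟩
    g zero * product (f ∘ suc) + sum (λ x → g (suc x) * (f zero * product-others (f ∘ suc) x)) ∎))
    where open SetoidReasoning setoid

  ^-ε : ∀ q k → (q , 0#) εX.^ k ε.≈ (q ^ k , 0#)
  ^-ε q zero    = ε.refl
  ^-ε q (suc k) = ε.trans (ε.*-congˡ {q , 0#} (^-ε q k))
    (refl , solve 2 (λ q p → q :* con 0 :+ con 0 :* p := con 0) refl q (q ^ k))

  listSum-ε : ∀ {a} {A : Set a} (f : A → ε.Carrier) xs →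
              proj₂ (εE.listSum f xs) ≡ listSum (proj₂ ∘ f) xs
  listSum-ε f []       = ≡.refl
  listSum-ε f (x ∷ xs) = cong (proj₂ (f x) +_) (listSum-ε f xs)

  -- `q` is given no ε-part, so the derivation acts on the letter weights only.
  enumerator-ε : ∀ n q w → proj₂ (εE.enumerator n (q , 0#) (w +ε ∂ w)) ≈
                           listSum (λ π → q ^ cyc π * leibniz w π) (permutations n)
  enumerator-ε n q w = trans
    (reflexive (listSum-ε (εE.permutationWeight (q , 0#) (w +ε ∂ w)) (permutations n)))
    (listSum-cong (λ π → proj₂ (permutationWeight-ε π)) (permutations n))
    where
    permutationWeight-ε : ∀ π → εE.permutationWeight (q , 0#) (w +ε ∂ w) π ε.≈
                                (permutationWeight q w π , q ^ cyc π * leibniz w π)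
    permutationWeight-ε π = ε.trans
      (ε.*-cong (^-ε q (cyc π)) (ε.trans
        (εE.product-cong (λ x → ε.reflexive (weight-+ε w (∂ w) (incoming π x) (outgoing π x))))
        (product-ε (letterWeight w π) (letterWeight (∂ w) π))))
      (refl , trans (+-congˡ (zeroˡ _)) (+-identityʳ _))

  infix 4 _∼_

  _∼_ : Weights → Weights → Set ℓ
  w ∼ w′ = peak w * valley w ≈ peak w′ * valley w′
         × ascent w + descent w ≈ ascent w′ + descent w′
         × fixed w ≈ fixed w′

-- The derivatives of the three quantities are functions of the same three: peak · valley goes to
-- peak · valley · (ascent + descent), ascent + descent to twice peak · valley, and fixed to peak ·
-- valley.
+ε∂-cong : ∀ {c ℓ} (R : CommutativeRing c ℓ) → let open Enumerator R in
           ∀ {w w′} → _∼_ R w w′ → _∼_ (dualNumbers R) (_+ε_ R w (∂ w)) (_+ε_ R w′ (∂ w′))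
+ε∂-cong R {w} {w′} (pv , ad , f) =
  (pv , (begin
    peak w * (valley w * (ascent w + descent w)) + 0# * valley w
      ≈⟨ expand _ _ _ ⟩
    peak w * valley w * (ascent w + descent w)
      ≈⟨ *-cong pv ad ⟩
    peak w′ * valley w′ * (ascent w′ + descent w′)
      ≈⟨ expand _ _ _ ⟨
    peak w′ * (valley w′ * (ascent w′ + descent w′)) + 0# * valley w′ ∎)) ,
  (ad , +-cong pv pv) ,
  (f , pv)
  where
  open CommutativeRing R
  open Enumerator R
  open SemiringSolver commutativeSemiring using (solve; _:+_; _:*_; _:=_; con)
  open SetoidReasoning setoid
  expand : ∀ p v s → p * (v * s) + 0# * v ≈ p * v * s
  expand = solve 3 (λ p v s → p :* (v :* s) :+ con 0 :* v := p :* v :* s) refl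

-- The ring varies in the induction: the step uses the hypothesis for `n` over `R` and again over
-- `dualNumbers R`, whose second components give the Leibniz terms.
enumerator-cong : ∀ {c ℓ} (R : CommutativeRing c ℓ) → let open CommutativeRing R; open Enumerator R in
                  ∀ n q {w w′} → _∼_ R w w′ → enumerator n q w ≈ enumerator n q w′
enumerator-cong R zero    q w∼w′ = CommutativeRing.refl R
enumerator-cong R (suc n) q {w} {w′} w∼w′@(_ , _ , f) = begin
  enumerator (suc n) q w
    ≈⟨ enumerator-suc n q w ⟩
  q * fixed w * enumerator n q w + listSum (λ π → q ^ cyc π * leibniz w π) (permutations n)
    ≈⟨ +-cong (*-cong (*-congˡ f) (enumerator-cong R n q w∼w′)) (begin
         listSum (λ π → q ^ cyc π * leibniz w π) (permutations n)
           ≈⟨ enumerator-ε R n q w ⟨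
         proj₂ (εE.enumerator n (q , 0#) (_+ε_ R w (∂ w)))
           ≈⟨ proj₂ (enumerator-cong (dualNumbers R) n (q , 0#) (+ε∂-cong R w∼w′)) ⟩
         proj₂ (εE.enumerator n (q , 0#) (_+ε_ R w′ (∂ w′)))
           ≈⟨ enumerator-ε R n q w′ ⟩
         listSum (λ π → q ^ cyc π * leibniz w′ π) (permutations n) ∎) ⟩
  q * fixed w′ * enumerator n q w′ + listSum (λ π → q ^ cyc π * leibniz w′ π) (permutations n)
    ≈⟨ enumerator-suc n q w′ ⟨
  enumerator (suc n) q w′ ∎
  where
  open CommutativeRing R
  open Exp semiring using (_^_)
  open Enumerator R
  module εE = Enumerator (dualNumbers R)
  open SetoidReasoning setoid

-- Derangements, cyclic peaks and excedances

isUp isDown : Direction → Bool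
isUp up   = true
isUp flat = false
isUp down = false
isDown up   = false
isDown flat = false
isDown down = true

does-<?-up : ∀ {n} (i j : Fin n) → does (i <? j) ≡ isUp (direction i j)
does-<?-up zero    zero    = ≡.refl
does-<?-up zero    (suc j) = ≡.refl
does-<?-up (suc i) zero    = ≡.refl
does-<?-up (suc i) (suc j) = does-<?-up i j

does-<?-down : ∀ {n} (i j : Fin n) → does (j <? i) ≡ isDown (direction i j)
does-<?-down zero    zero    = ≡.refl
does-<?-down zero    (suc j) = ≡.refl
does-<?-down (suc i) zero    = ≡.refl
does-<?-down (suc i) (suc j) = does-<?-down i j

module _ {n} (σ : Permutation′ n) where

  outgoing-flat : ∀ {x} → outgoing σ x ≡ flat → σ ⟨$⟩ʳ x ≡ x
  outgoing-flat {x} eq = ≡.sym (direction-flat x _ eq)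

  incoming-flat : ∀ {x} → incoming σ x ≡ flat → σ ⟨$⟩ʳ x ≡ x
  incoming-flat {x} eq = ≡.trans (cong (σ ⟨$⟩ʳ_) (≡.sym (direction-flat _ x eq))) (inverseʳ σ)

  incoming-fixed : ∀ {x} → σ ⟨$⟩ʳ x ≡ x → incoming σ x ≡ flat
  incoming-fixed {x} eq = ≡.trans
    (cong (λ y → direction y x) (≡.trans (cong (σ ⟨$⟩ˡ_) (≡.sym eq)) (inverseˡ σ))) (direction-refl x)

  outgoing-fixed : ∀ {x} → σ ⟨$⟩ʳ x ≡ x → outgoing σ x ≡ flat
  outgoing-fixed {x} eq = ≡.trans (cong (direction x) eq) (direction-refl x)

module _ {c ℓ} (R : CommutativeRing c ℓ) where

  open CommutativeRing R hiding (zero)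
  open GeneratingFunctions R using (P; D)
  open Exp semiring using (_^_)
  open Enumerator R
  private
    module Π = Sum *-commutativeMonoid
  open SemiringSolver commutativeSemiring using (solve; _:*_; _:=_; con)
  open SetoidReasoning setoid

  1^k≈1 : ∀ k → 1# ^ k ≈ 1#
  1^k≈1 zero    = refl
  1^k≈1 (suc k) = trans (*-identityˡ _) (1^k≈1 k)

  listSum-filter : ∀ {a p} {A : Set a} {Q : Pred A p} (Q? : Decidable Q) {f g : A → Carrier} →
                   (∀ {x} → Q x → f x ≈ g x) → (∀ {x} → ¬ Q x → g x ≈ 0#) →
                   ∀ xs → listSum f (filter Q? xs) ≈ listSum g xs
  listSum-filter Q? f≈g g≈0 []       = refl
  listSum-filter Q? f≈g g≈0 (x ∷ xs) with Q? x
  ... | yes qx = +-cong (f≈g qx) (listSum-filter Q? f≈g g≈0 xs)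
  ... | no ¬qx = trans (listSum-filter Q? f≈g g≈0 xs) (sym (trans (+-congʳ (g≈0 ¬qx)) (+-identityˡ _)))

  ^-length-filter : ∀ t {a p} {A : Set a} {Q : Pred A p} (Q? : Decidable Q) {n} (f : Fin n → A) →
    t ^ length (filter Q? (tabulate f)) ≈ product (λ x → if does (Q? (f x)) then t else 1#)
  ^-length-filter t Q? {zero}  f = refl
  ^-length-filter t Q? {suc n} f with does (Q? (f zero))
  ... | true  = *-congˡ (^-length-filter t Q? (f ∘ suc))
  ... | false = trans (^-length-filter t Q? (f ∘ suc)) (sym (*-identityˡ _))

  -- Every letter carries `z`, a peak also `x`, and a letter with ascending outgoing side, that is
  -- an excedance, also `t`. So peak · valley is z²xt and ascent + descent is z(1 + t).
  derangementWeights : Carrier → Carrier → Carrier → Weights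
  derangementWeights z x t = weights (z * x) (z * t) (z * t) z 0#

  module _ (z x t : Carrier) where

    private
      w = derangementWeights z x t

    weight-indicators : ∀ d e → d ≢ flat → e ≢ flat →
      weight w d e ≈ z * ((if isUp d ∧ isDown e then x else 1#) * (if isUp e then t else 1#))
    weight-indicators up   up   _ _ = *-congˡ (sym (*-identityˡ t))
    weight-indicators up   down _ _ = *-congˡ (sym (*-identityʳ x))
    weight-indicators down up   _ _ = *-congˡ (sym (*-identityˡ t))
    weight-indicators down down _ _ = sym (trans (*-congˡ (*-identityˡ 1#)) (*-identityʳ z))
    weight-indicators flat e    d _ = contradiction ≡.refl d
    weight-indicators up   flat _ e = contradiction ≡.refl e
    weight-indicators down flat _ e = contradiction ≡.refl e

    product-derangement : ∀ {n} (σ : Permutation′ n) → IsDerangement σ →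
                          product (letterWeight w σ) ≈ z ^ n * (x ^ cpk σ * t ^ exc σ)
    product-derangement {n} σ deranged = sym (begin
      z ^ n * (x ^ cpk σ * t ^ exc σ)
        ≈⟨ *-cong (sym (Π.sum-replicate n {z}))
             (*-cong (^-length-filter x (λ i → ((σ ⟨$⟩ˡ i) <? i) ×-dec ((σ ⟨$⟩ʳ i) <? i)) id)
                     (^-length-filter t (λ i → i <? (σ ⟨$⟩ʳ i)) id)) ⟩
      product {n} (λ _ → z) * (product cpkFactor * product excFactor)
        -- `Π` is `Sum` for the multiplicative monoid, so `∑-distrib-+` merges products.
        ≈⟨ *-congˡ (Π.∑-distrib-+ cpkFactor excFactor) ⟨
      product {n} (λ _ → z) * product (λ i → cpkFactor i * excFactor i)
        ≈⟨ Π.∑-distrib-+ (λ _ → z) (λ i → cpkFactor i * excFactor i) ⟨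
      product (λ i → z * (cpkFactor i * excFactor i))
        ≈⟨ product-cong (λ i → sym (letter i)) ⟩
      product (letterWeight w σ) ∎)
      where
      cpkFactor excFactor : Fin n → Carrier
      cpkFactor i = if does ((σ ⟨$⟩ˡ i) <? i) ∧ does ((σ ⟨$⟩ʳ i) <? i) then x else 1#
      excFactor i = if does (i <? (σ ⟨$⟩ʳ i)) then t else 1#
      letter : ∀ i → letterWeight w σ i ≈ z * (cpkFactor i * excFactor i)
      letter i rewrite does-<?-up (σ ⟨$⟩ˡ i) i | does-<?-down i (σ ⟨$⟩ʳ i) | does-<?-up i (σ ⟨$⟩ʳ i) =
        weight-indicators (incoming σ i) (outgoing σ i)
          (deranged i ∘ incoming-flat σ) (deranged i ∘ outgoing-flat σ)

    product-fixed-point : ∀ {n} (σ : Permutation′ n) → ¬ IsDerangement σ → product (letterWeight w σ) ≈ 0#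
    product-fixed-point {n} σ ¬deranged
      with i , ¬i≢ ← ¬∀⟶∃¬ n _ (λ i → ¬? (σ ⟨$⟩ʳ i ≟ i)) ¬deranged =
      begin
        product (letterWeight w σ)
          ≈⟨ product-replace i (λ _ _ → refl) ⟩
        letterWeight w σ i * product-others (letterWeight w σ) i
          ≈⟨ *-congʳ (reflexive (cong₂ (weight w) (incoming-fixed σ fixes) (outgoing-fixed σ fixes))) ⟩
        0# * product-others (letterWeight w σ) i
          ≈⟨ zeroˡ _ ⟩
        0# ∎
      where
      fixes : σ ⟨$⟩ʳ i ≡ i
      fixes = decidable-stable (σ ⟨$⟩ʳ i ≟ i) ¬i≢

    enumerator-derangements : ∀ n q →
      enumerator n q w ≈ z ^ n * P (cyc ∷ cpk ∷ exc ∷ []) (𝔇 n) (q ∷ x ∷ t ∷ [])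
    enumerator-derangements n q = sym (begin
      z ^ n * P (cyc ∷ cpk ∷ exc ∷ []) (𝔇 n) (q ∷ x ∷ t ∷ [])
        ≈⟨ *-distribˡ-listSum (z ^ n) _ (𝔇 n) ⟩
      listSum (λ σ → z ^ n * (q ^ cyc σ * (x ^ cpk σ * (t ^ exc σ * 1#)))) (𝔇 n)
        ≈⟨ listSum-filter isDerangement?
             (λ {σ} deranged → trans
               (solve 4 (λ z q x t → z :* (q :* (x :* (t :* con 1))) := q :* (z :* (x :* t))) refl _ _ _ _)
               (*-congˡ (sym (product-derangement σ deranged))))
             (λ {σ} ¬deranged → trans (*-congˡ (product-fixed-point σ ¬deranged)) (zeroʳ _))
             (permutations n) ⟩
      enumerator n q w ∎)

  -- Setting the peak variable to 1 forgets the cyclic peaks.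
  D≈P : ∀ n q t → D n q t ≈ P (cyc ∷ cpk ∷ exc ∷ []) (𝔇 n) (q ∷ 1# ∷ t ∷ [])
  D≈P n q t = listSum-cong (λ σ → *-congˡ (sym (trans (*-congʳ (1^k≈1 (cpk σ))) (*-identityˡ _)))) (𝔇 n)

-- A ring solver whose coefficients are formal differences of natural numbers.
-- Unlike coefficients in R itself they have decidable equality, so that terms
-- cancel.

module DifferenceSolver {c ℓ} (R : CommutativeRing c ℓ) where

  open CommutativeRing R hiding (zero)
  open Mult semiring using (×1-homo-*; ×-homo-+) renaming (_×_ to _·_)
  open SetoidReasoning setoid
  private
    module S = SemiringSolver commutativeSemiring
    open RingProperties ring using (-‿distribˡ-*; -‿distribʳ-*; -‿involutive; -0#≈0#)
    open AbelianGroupProperties +-abelianGroup using (⁻¹-∙-comm)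

  -- One entry of a reduced pair is zero, so equal differences reduce to the same pair and normal
  -- forms can coincide syntactically.
  reduce : ℕ × ℕ → ℕ × ℕ
  reduce (suc a , suc b) = reduce (a , b)
  reduce (a     , zero)  = a , zero
  reduce (zero  , b)     = zero , b

  reduce-correct : ∀ p → proj₁ (reduce p) ℕ.+ proj₂ p ≡ proj₁ p ℕ.+ proj₂ (reduce p)
  reduce-correct (suc a , suc b) = ≡.trans (ℕₚ.+-suc _ b) (≡.cong suc (reduce-correct (a , b)))
  reduce-correct (zero  , zero)  = ≡.refl
  reduce-correct (suc a , zero)  = ≡.refl
  reduce-correct (zero  , suc b) = ≡.refl

  differences : RawRing 0ℓ 0ℓ
  differences = record
    { Carrier = ℕ × ℕ
    ; _≈_ = _≡_
    ; _+_ = λ (a , b) (c , d) → reduce (a ℕ.+ c , b ℕ.+ d)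
    ; _*_ = λ (a , b) (c , d) → reduce (a ℕ.* c ℕ.+ b ℕ.* d , a ℕ.* d ℕ.+ b ℕ.* c)
    ; -_  = λ (a , b) → b , a
    ; 0#  = 0 , 0
    ; 1#  = 1 , 0
    }

  open RawRing differences using () renaming (_+_ to _⊕_; _*_ to _⊛_; -_ to ⊖_)

  -- The case n = 0 is separated so that 0# and 1# are values definitionally.

  value : ℕ × ℕ → Carrier
  value (m , zero)  = m · 1#
  value (m , suc n) = m · 1# - suc n · 1#

  value≈ : ∀ p → value p ≈ proj₁ p · 1# - proj₂ p · 1#
  value≈ (m , zero)  = sym (trans (+-congˡ -0#≈0#) (+-identityʳ _))
  value≈ (m , suc n) = refl

  -- Padding each difference with the subtrahend of the other gives a common subtrahend `b + d` and
  -- the minuends `a + d` and `c + b`, equal by hypothesis.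
  value-cong : ∀ p q → proj₁ p ℕ.+ proj₂ q ≡ proj₁ q ℕ.+ proj₂ p → value p ≈ value q
  value-cong p@(a , b) q@(c , d) eq = begin
    value p                                  ≈⟨ value≈ p ⟩
    a · 1# - b · 1#                          ≈⟨ padded (a · 1#) (b · 1#) (d · 1#) ⟩
    (a · 1# + d · 1#) + (- (b · 1#) - d · 1#) ≈⟨ +-congʳ (×-homo-+ 1# a d) ⟨
    (a ℕ.+ d) · 1# + (- (b · 1#) - d · 1#)   ≡⟨ ≡.cong (λ k → k · 1# + (- (b · 1#) - d · 1#)) eq ⟩
    (c ℕ.+ b) · 1# + (- (b · 1#) - d · 1#)   ≈⟨ +-cong (×-homo-+ 1# c b) (+-comm _ _) ⟩
    (c · 1# + b · 1#) + (- (d · 1#) - b · 1#) ≈⟨ padded (c · 1#) (d · 1#) (b · 1#) ⟨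
    c · 1# - d · 1#                          ≈⟨ value≈ q ⟨
    value q                                  ∎
    where
    padded : ∀ x y z → x - y ≈ (x + z) + (- y - z)
    padded x y z = begin
      x - y                ≈⟨ +-identityʳ _ ⟨
      (x - y) + 0#         ≈⟨ +-congˡ (-‿inverseʳ z) ⟨
      (x - y) + (z - z)    ≈⟨ S.solve 4 (λ x y z w → (x S.:+ y) S.:+ (z S.:+ w)
                                S.:= (x S.:+ z) S.:+ (y S.:+ w)) refl _ _ _ _ ⟩
      (x + z) + (- y - z)  ∎

  value-reduce : ∀ p → value (reduce p) ≈ proj₁ p · 1# - proj₂ p · 1#
  value-reduce p = trans (value-cong (reduce p) p (reduce-correct p)) (value≈ p)

  value-+ : ∀ p q → value (p ⊕ q) ≈ value p + value q
  value-+ p@(a , b) q@(c , d) = begin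
    value (p ⊕ q)                            ≈⟨ value-reduce (a ℕ.+ c , b ℕ.+ d) ⟩
    (a ℕ.+ c) · 1# - (b ℕ.+ d) · 1#          ≈⟨ +-cong (×-homo-+ 1# a c) (-‿cong (×-homo-+ 1# b d)) ⟩
    (a · 1# + c · 1#) - (b · 1# + d · 1#)    ≈⟨ +-congˡ (⁻¹-∙-comm _ _) ⟨
    (a · 1# + c · 1#) + (- (b · 1#) - d · 1#) ≈⟨ S.solve 4 (λ a b c d →
      (a S.:+ c) S.:+ (b S.:+ d) S.:= (a S.:+ b) S.:+ (c S.:+ d)) refl _ _ _ _ ⟩
    (a · 1# - b · 1#) + (c · 1# - d · 1#)    ≈⟨ +-cong (value≈ p) (value≈ q) ⟨
    value p + value q                        ∎

  value-* : ∀ p q → value (p ⊛ q) ≈ value p * value q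
  value-* p@(a , b) q@(c , d) = begin
    value (p ⊛ q)
      ≈⟨ value-reduce (a ℕ.* c ℕ.+ b ℕ.* d , a ℕ.* d ℕ.+ b ℕ.* c) ⟩
    (a ℕ.* c ℕ.+ b ℕ.* d) · 1# - (a ℕ.* d ℕ.+ b ℕ.* c) · 1#
      ≈⟨ +-cong (sum-of-products a c b d) (-‿cong (sum-of-products a d b c)) ⟩
    (a · 1# * (c · 1#) + b · 1# * (d · 1#)) - (a · 1# * (d · 1#) + b · 1# * (c · 1#))
      -- Signs are absorbed into the factors, using bd = (-b)(-d); what remains is a semiring
      -- identity with the negatives as atoms.
      ≈⟨ +-cong (+-congˡ (trans (*-cong (sym (-‿involutive _)) refl) (trans (sym (-‿distribˡ-* _ _)) (-‿distribʳ-* _ _))))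
           (trans (sym (⁻¹-∙-comm _ _)) (+-cong (-‿distribʳ-* _ _) (-‿distribˡ-* _ _))) ⟩
    (a · 1# * (c · 1#) + - (b · 1#) * - (d · 1#)) + (a · 1# * - (d · 1#) + - (b · 1#) * (c · 1#))
      ≈⟨ S.solve 4 (λ a b c d → (a S.:* c S.:+ b S.:* d) S.:+ (a S.:* d S.:+ b S.:* c)
           S.:= (a S.:+ b) S.:* (c S.:+ d)) refl _ _ _ _ ⟩
    (a · 1# - b · 1#) * (c · 1# - d · 1#)
      ≈⟨ *-cong (value≈ p) (value≈ q) ⟨
    value p * value q ∎
    where
    sum-of-products : ∀ a c b d → (a ℕ.* c ℕ.+ b ℕ.* d) · 1# ≈ a · 1# * (c · 1#) + b · 1# * (d · 1#)
    sum-of-products a c b d = trans (×-homo-+ 1# (a ℕ.* c) (b ℕ.* d)) (+-cong (×1-homo-* a c) (×1-homo-* b d))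

  value-- : ∀ p → value (⊖ p) ≈ - value p
  value-- p@(a , b) = begin
    value (⊖ p)          ≈⟨ value≈ (⊖ p) ⟩
    b · 1# - a · 1#      ≈⟨ +-comm _ _ ⟩
    - (a · 1#) + b · 1#  ≈⟨ +-congˡ (-‿involutive _) ⟨
    - (a · 1#) - - (b · 1#) ≈⟨ ⁻¹-∙-comm _ _ ⟩
    - (a · 1# - b · 1#)  ≈⟨ -‿cong (value≈ p) ⟨
    - value p            ∎

  homomorphism : differences -Raw-AlmostCommutative⟶ fromCommutativeRing R
  homomorphism = record
    { ⟦_⟧    = value
    ; +-homo = value-+
    ; *-homo = value-*
    ; -‿homo = value--
    ; 0-homo = refl
    ; 1-homo = refl
    }

  value≟ : ∀ p q → Maybe (value p ≈ value q)
  value≟ p@(a , b) q@(c , d) with a ℕ.+ d ℕₚ.≟ c ℕ.+ b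
  ... | yes eq = just (value-cong p q eq)
  ... | no _   = nothing

  open RingSolver differences (fromCommutativeRing R) homomorphism value≟ public
    using (Polynomial; solve; con; _:+_; _:*_; _:-_; _:^_; _:=_)

-- Weights of the two identities

module _ {c ℓ} (R : CommutativeRing c ℓ) where

  open CommutativeRing R hiding (zero)
  open GeneratingFunctions R
  open SetoidReasoning setoid
  open DifferenceSolver R

  private
    :1 :2 :4 : ∀ {n} → Polynomial n
    :1 = con (1 , 0)
    :2 = :1 :+ :1
    :4 = :2 :+ :2

  unit-cancelˡ : ∀ a {x y} → IsUnit a → a * x ≈ a * y → x ≈ y
  unit-cancelˡ a {x} {y} (a⁻¹ , inverseˡ , _) eq = begin
    x               ≈⟨ shift x ⟨
    a⁻¹ * (a * x)   ≈⟨ *-congˡ eq ⟩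
    a⁻¹ * (a * y)   ≈⟨ shift y ⟩
    y               ∎
    where
    shift : ∀ z → a⁻¹ * (a * z) ≈ z
    shift z = trans (sym (*-assoc _ _ _)) (trans (*-congʳ inverseˡ) (*-identityˡ z))

  -- Makes `2#`, `2β` and `2α - 2#` invertible, as divisors of units built from the given
  -- denominators.
  unit-factorˡ : ∀ {a} b {k} → IsUnit k → a * b ≈ k → IsUnit a
  unit-factorˡ {a} b (k⁻¹ , inverseˡ , inverseʳ) ab≈k =
    b * k⁻¹ , trans (*-comm _ _) right , right
    where
    right : a * (b * k⁻¹) ≈ 1#
    right = trans (sym (*-assoc _ _ _)) (trans (*-congʳ ab≈k) inverseʳ)

  unit-* : ∀ {a b} → IsUnit a → IsUnit b → IsUnit (a * b)
  unit-* {a} {b} (a⁻¹ , _ , aa⁻¹) (b⁻¹ , _ , bb⁻¹) = a⁻¹ * b⁻¹ , trans (*-comm _ _) right , right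
    where
    right : a * b * (a⁻¹ * b⁻¹) ≈ 1#
    right = begin
      a * b * (a⁻¹ * b⁻¹)      ≈⟨ solve 4 (λ a b c d → a :* b :* (c :* d) := (a :* c) :* (b :* d)) refl _ _ _ _ ⟩
      (a * a⁻¹) * (b * b⁻¹)    ≈⟨ *-cong aa⁻¹ bb⁻¹ ⟩
      1# * 1#                  ≈⟨ *-identityˡ 1# ⟩
      1#                       ∎

  /-cancel : ∀ a b ⦃ u : IsUnit b ⦄ → b * (a / b) ≈ a
  /-cancel a b ⦃ b⁻¹ , _ , bb⁻¹ ⦄ = begin
    b * (a * b⁻¹)   ≈⟨ solve 3 (λ a b c → b :* (a :* c) := a :* (b :* c)) refl _ _ _ ⟩
    a * (b * b⁻¹)   ≈⟨ *-congˡ bb⁻¹ ⟩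
    a * 1#          ≈⟨ *-identityʳ a ⟩
    a               ∎

  open Enumerator R using (enumerator)

  -- The hypotheses are the first two equations of `_∼_` for the weights of derangements; both fixed
  -- weights are `0#`.
  P-transfer : ∀ n q z x t z′ x′ t′ →
    z * x * (z * t) ≈ z′ * x′ * (z′ * t′) → z * t + z ≈ z′ * t′ + z′ →
    z ^ n * P (cyc ∷ cpk ∷ exc ∷ []) (𝔇 n) (q ∷ x ∷ t ∷ []) ≈
    z′ ^ n * P (cyc ∷ cpk ∷ exc ∷ []) (𝔇 n) (q ∷ x′ ∷ t′ ∷ [])
  P-transfer n q z x t z′ x′ t′ pv ad = begin
    z ^ n * P (cyc ∷ cpk ∷ exc ∷ []) (𝔇 n) (q ∷ x ∷ t ∷ [])
      ≈⟨ enumerator-derangements R z x t n q ⟨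
    enumerator n q (derangementWeights R z x t)
      ≈⟨ enumerator-cong R n q (pv , ad , refl) ⟩
    enumerator n q (derangementWeights R z′ x′ t′)
      ≈⟨ enumerator-derangements R z′ x′ t′ n q ⟩
    z′ ^ n * P (cyc ∷ cpk ∷ exc ∷ []) (𝔇 n) (q ∷ x′ ∷ t′ ∷ []) ∎

  1^n*a≈a : ∀ n a → 1# ^ n * a ≈ a
  1^n*a≈a n a = trans (*-congʳ (1^k≈1 R n)) (*-identityˡ a)

  module _ (t x : Carrier) ⦃ a : IsUnit (1# + x) ⦄ ⦃ b : IsUnit (1# + x * t) ⦄
           ⦃ k : IsUnit ((x + t) * (1# + x * t)) ⦄ where

    private
      z = (1# + x * t) / (1# + x)
      X = (1# + x) ^ 2 * t / ((x + t) * (1# + x * t))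
      Y = (x + t) / (1# + x * t)
      zY : (1# + x) * (z * Y) ≈ x + t
      zY = trans (sym (*-assoc _ _ _)) (trans (*-congʳ (/-cancel _ _)) (/-cancel _ _))

    -- `z * Y` is (x + t)/(1 + x), so z²Y is (x + t)(1 + xt)/(1 + x)², which the factor `X` turns
    -- into t.
    first-peak-valley : 1# * 1# * (1# * t) ≈ z * X * (z * Y)
    first-peak-valley = unit-cancelˡ ((1# + x) ^ 2 * ((x + t) * (1# + x * t)))
      -- The inverse of `1#` enters because `(1# + x) ^ 2` unfolds to a product ending in `1#`.
      (unit-* (unit-* a (unit-* a (1# , *-identityˡ 1# , *-identityˡ 1#))) k) (begin
        (1# + x) ^ 2 * s * (1# * 1# * (1# * t))
          ≈⟨ solve 3 (λ a s t → a :^ 2 :* s :* (:1 :* :1 :* (:1 :* t)) := s :* (a :^ 2 :* t)) refl _ _ _ ⟩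
        s * ((1# + x) ^ 2 * t)
          ≈⟨ *-cong (*-comm _ _) (sym (/-cancel _ s)) ⟩
        (1# + x * t) * (x + t) * (s * X)
          ≈⟨ *-congʳ (*-cong (sym (/-cancel _ (1# + x))) (sym zY)) ⟩
        (1# + x) * z * ((1# + x) * (z * Y)) * (s * X)
          ≈⟨ solve 5 (λ a z y s x → a :* z :* (a :* (z :* y)) :* (s :* x) :=
               a :^ 2 :* s :* (z :* x :* (z :* y))) refl _ _ _ _ _ ⟩
        (1# + x) ^ 2 * s * (z * X * (z * Y)) ∎)
      where s = (x + t) * (1# + x * t)

    first-ascent-descent : 1# * t + 1# ≈ z * Y + z
    first-ascent-descent = unit-cancelˡ (1# + x) a (begin
      (1# + x) * (1# * t + 1#)
        ≈⟨ solve 2 (λ x t → (:1 :+ x) :* (:1 :* t :+ :1) := (x :+ t) :+ (:1 :+ x :* t)) refl x t ⟩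
      (x + t) + (1# + x * t)
        ≈⟨ +-cong zY (/-cancel _ (1# + x)) ⟨
      (1# + x) * (z * Y) + (1# + x) * z
        ≈⟨ distribˡ _ _ _ ⟨
      (1# + x) * (z * Y + z) ∎)

  -- With 2α = 1 + t + s and 2β = 1 + t - s one has α + β = 1 + t, αβ = xt,
  -- v = β / α and u = (α - 1) / (1 - β), whence (1 + u) / (1 + uv) = α.

  module _ (x t s : Carrier) (s² : s ^ 2 ≈ discriminant x t)
           ⦃ A : IsUnit (2# * (1# - x) * t) ⦄ ⦃ B : IsUnit (2# * x * t) ⦄ where

    private
      u = 𝑢 x t s
      v = 𝑣 x t s
      2α = 1# + t + s
      2β = 1# + t - s

    unit-2 : IsUnit 2#
    unit-2 = unit-factorˡ (x * t) B (sym (*-assoc _ _ _))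

    2α*2β : 2α * 2β ≈ 2# * (2# * x * t)
    2α*2β = begin
      2α * 2β
        ≈⟨ solve 2 (λ t s → (:1 :+ t :+ s) :* (:1 :+ t :- s) := (:1 :+ t) :^ 2 :- s :^ 2) refl t s ⟩
      (1# + t) ^ 2 - s ^ 2
        ≈⟨ +-congˡ (-‿cong s²) ⟩
      (1# + t) ^ 2 - discriminant x t
        ≈⟨ solve 2 (λ x t → (:1 :+ t) :^ 2 :- ((:1 :+ t) :^ 2 :- :4 :* x :* t) := :2 :* (:2 :* x :* t)) refl x t ⟩
      2# * (2# * x * t) ∎

    -- `2α * 2β` is twice the denominator of `v`, and replacing the discriminant by s² turns twice
    -- its numerator into (2β)². The factor `2β` cancels as a divisor of a unit.
    2α*v : 2α * v ≈ 2β
    2α*v = unit-cancelˡ 2β (unit-factorˡ 2α (unit-* unit-2 B) (trans (*-comm _ _) 2α*2β)) (begin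
      2β * (2α * v)
        ≈⟨ solve 3 (λ a b v → b :* (a :* v) := a :* b :* v) refl _ _ _ ⟩
      2α * 2β * v
        ≈⟨ *-congʳ 2α*2β ⟩
      2# * (2# * x * t) * v
        ≈⟨ trans (*-assoc _ _ _) (*-congˡ (/-cancel _ _)) ⟩
      2# * ((1# + t) ^ 2 - 2# * x * t - (1# + t) * s)
        ≈⟨ solve 3 (λ x t s → :2 :* ((:1 :+ t) :^ 2 :- :2 :* x :* t :- (:1 :+ t) :* s) :=
             ((:1 :+ t) :^ 2 :- :4 :* x :* t) :+ ((:1 :+ t) :^ 2 :- :2 :* (:1 :+ t) :* s)) refl x t s ⟩
      discriminant x t + ((1# + t) ^ 2 - 2# * (1# + t) * s)
        ≈⟨ +-congʳ s² ⟨
      s ^ 2 + ((1# + t) ^ 2 - 2# * (1# + t) * s)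
        ≈⟨ solve 2 (λ t s → s :^ 2 :+ ((:1 :+ t) :^ 2 :- :2 :* (:1 :+ t) :* s) :=
             (:1 :+ t :- s) :* (:1 :+ t :- s)) refl t s ⟩
      2β * 2β ∎)

    -- Likewise (2α - 2)(2 - 2β) is twice the denominator of `u`, and twice its numerator becomes
    -- (2α - 2)².
    [2-2β]*u : (2# - 2β) * u ≈ 2α - 2#
    [2-2β]*u = unit-cancelˡ (2α - 2#)
      (unit-factorˡ (2# - 2β) (unit-* unit-2 A) [2α-2]*[2-2β]) (begin
      (2α - 2#) * ((2# - 2β) * u)
        ≈⟨ *-assoc _ _ _ ⟨
      (2α - 2#) * (2# - 2β) * u
        ≈⟨ *-congʳ [2α-2]*[2-2β] ⟩
      2# * (2# * (1# - x) * t) * u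
        ≈⟨ trans (*-assoc _ _ _) (*-congˡ (/-cancel _ _)) ⟩
      2# * (1# + t ^ 2 - 2# * x * t - (1# - t) * s)
        ≈⟨ solve 3 (λ x t s → :2 :* (:1 :+ t :^ 2 :- :2 :* x :* t :- (:1 :- t) :* s) :=
             ((:1 :+ t) :^ 2 :- :4 :* x :* t) :+ ((:1 :- t) :^ 2 :- :2 :* (:1 :- t) :* s)) refl x t s ⟩
      discriminant x t + ((1# - t) ^ 2 - 2# * (1# - t) * s)
        ≈⟨ +-congʳ s² ⟨
      s ^ 2 + ((1# - t) ^ 2 - 2# * (1# - t) * s)
        ≈⟨ solve 2 (λ t s → s :^ 2 :+ ((:1 :- t) :^ 2 :- :2 :* (:1 :- t) :* s) :=
             (:1 :+ t :+ s :- :2) :* (:1 :+ t :+ s :- :2)) refl t s ⟩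
      (2α - 2#) * (2α - 2#) ∎)
      where
      [2α-2]*[2-2β] : (2α - 2#) * (2# - 2β) ≈ 2# * (2# * (1# - x) * t)
      [2α-2]*[2-2β] = begin
        (2α - 2#) * (2# - 2β)
          ≈⟨ solve 2 (λ t s → (:1 :+ t :+ s :- :2) :* (:2 :- (:1 :+ t :- s)) := s :^ 2 :- (:1 :- t) :^ 2) refl t s ⟩
        s ^ 2 - (1# - t) ^ 2
          ≈⟨ +-congʳ s² ⟩
        discriminant x t - (1# - t) ^ 2
          ≈⟨ solve 2 (λ x t → ((:1 :+ t) :^ 2 :- :4 :* x :* t) :- (:1 :- t) :^ 2 :=
               :2 :* (:2 :* (:1 :- x) :* t)) refl x t ⟩
        2# * (2# * (1# - x) * t) ∎

    module _ ⦃ w : IsUnit (1# + u * v) ⦄ where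

      private
        y = (1# + u) / (1# + u * v)

      -- 2 + 2u = 2 + (2 - 2β)u + 2βu, which the relations for `u` and `v` turn into 2α + 2α · uv.
      2*y : 2# * y ≈ 2α
      2*y = unit-cancelˡ (1# + u * v) w (begin
        (1# + u * v) * (2# * y)
          ≈⟨ solve 3 (λ c a y → c :* (a :* y) := a :* (c :* y)) refl (1# + u * v) 2# y ⟩
        2# * ((1# + u * v) * y)
          ≈⟨ *-congˡ (/-cancel _ _) ⟩
        2# * (1# + u)
          ≈⟨ solve 2 (λ u b → :2 :* (:1 :+ u) := :2 :+ (:2 :- b) :* u :+ b :* u) refl u 2β ⟩
        2# + (2# - 2β) * u + 2β * u
          ≈⟨ +-cong (+-congˡ [2-2β]*u) (*-congʳ (sym 2α*v)) ⟩
        2# + (2α - 2#) + 2α * v * u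
          ≈⟨ solve 3 (λ a u v → :2 :+ (a :- :2) :+ a :* v :* u := (:1 :+ u :* v) :* a) refl 2α u v ⟩
        (1# + u * v) * 2α ∎)

      -- After cancelling the unit 2, `y` is α and `y * v` is β, so this is αβ = xt;
      -- `second-ascent-descent` is α + β = 1 + t in the same way.
      second-peak-valley : 1# * x * (1# * t) ≈ y * 1# * (y * v)
      second-peak-valley = unit-cancelˡ (2# * 2#) (unit-* unit-2 unit-2) (begin
        2# * 2# * (1# * x * (1# * t))
          ≈⟨ solve 2 (λ x t → :2 :* :2 :* (:1 :* x :* (:1 :* t)) := :2 :* (:2 :* x :* t)) refl x t ⟩
        2# * (2# * x * t)
          ≈⟨ 2α*2β ⟨
        2α * 2β
          ≈⟨ *-congˡ 2α*v ⟨
        2α * (2α * v)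
          ≈⟨ *-cong 2*y (*-congʳ 2*y) ⟨
        2# * y * (2# * y * v)
          ≈⟨ solve 2 (λ y v → :2 :* y :* (:2 :* y :* v) := :2 :* :2 :* (y :* :1 :* (y :* v))) refl y v ⟩
        2# * 2# * (y * 1# * (y * v)) ∎)

      second-ascent-descent : 1# * t + 1# ≈ y * v + y
      second-ascent-descent = unit-cancelˡ 2# unit-2 (begin
        2# * (1# * t + 1#)
          ≈⟨ solve 2 (λ t s → :2 :* (:1 :* t :+ :1) := (:1 :+ t :- s) :+ (:1 :+ t :+ s)) refl t s ⟩
        2β + 2α
          ≈⟨ +-cong 2α*v refl ⟨
        2α * v + 2α
          ≈⟨ +-cong (*-congʳ 2*y) 2*y ⟨
        2# * y * v + 2# * y
          ≈⟨ solve 2 (λ y v → :2 :* y :* v :+ :2 :* y := :2 :* (y :* v :+ y)) refl y v ⟩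
        2# * (y * v + y) ∎)

-- Both identities as instances of the transfer between derangement weights.

theorem3p9 : ∀ {c ℓ} (R : CommutativeRing c ℓ) (n : ℕ) → n ≥ 1 →
    let open CommutativeRing R
        open GeneratingFunctions R
    in
    (∀ (q t x : Carrier) →
      ⦃ _ : IsUnit (1# + x) ⦄ → ⦃ _ : IsUnit (1# + x * t) ⦄ →
      ⦃ _ : IsUnit ((x + t) * (1# + x * t)) ⦄ →
      D n q t
        ≈ ((1# + x * t) / (1# + x)) ^ n
          * P (cyc ∷ cpk ∷ exc ∷ []) (𝔇 n)
              (q ∷ (1# + x) ^ 2 * t / ((x + t) * (1# + x * t)) ∷ (x + t) / (1# + x * t) ∷ []))
    ×
    (∀ (q x t √Δ : Carrier) → √Δ ^ 2 ≈ discriminant x t →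
      ⦃ _ : IsUnit (2# * (1# - x) * t) ⦄ → ⦃ _ : IsUnit (2# * x * t) ⦄ →
      let u = 𝑢 x t √Δ
          v = 𝑣 x t √Δ
      in
      ⦃ _ : IsUnit (1# + u * v) ⦄ →
      P (cyc ∷ cpk ∷ exc ∷ []) (𝔇 n) (q ∷ x ∷ t ∷ [])
        ≈ ((1# + u) / (1# + u * v)) ^ n * D n q v)
theorem3p9 R n _ =
  (λ q t x → begin
    D n q t
      ≈⟨ D≈P R n q t ⟩
    P (cyc ∷ cpk ∷ exc ∷ []) (𝔇 n) (q ∷ 1# ∷ t ∷ [])
      ≈⟨ 1^n*a≈a R n _ ⟨
    1# ^ n * P (cyc ∷ cpk ∷ exc ∷ []) (𝔇 n) (q ∷ 1# ∷ t ∷ [])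
      ≈⟨ P-transfer R n q _ _ _ _ _ _ (first-peak-valley R t x) (first-ascent-descent R t x) ⟩
    ((1# + x * t) / (1# + x)) ^ n
      * P (cyc ∷ cpk ∷ exc ∷ []) (𝔇 n)
          (q ∷ (1# + x) ^ 2 * t / ((x + t) * (1# + x * t)) ∷ (x + t) / (1# + x * t) ∷ []) ∎) ,
  (λ q x t √Δ √Δ² → let u = 𝑢 x t √Δ ; v = 𝑣 x t √Δ in begin
    P (cyc ∷ cpk ∷ exc ∷ []) (𝔇 n) (q ∷ x ∷ t ∷ [])
      ≈⟨ 1^n*a≈a R n _ ⟨
    1# ^ n * P (cyc ∷ cpk ∷ exc ∷ []) (𝔇 n) (q ∷ x ∷ t ∷ [])
      ≈⟨ P-transfer R n q _ _ _ _ _ _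
           (second-peak-valley R x t √Δ √Δ²) (second-ascent-descent R x t √Δ √Δ²) ⟩
    ((1# + u) / (1# + u * v)) ^ n * P (cyc ∷ cpk ∷ exc ∷ []) (𝔇 n) (q ∷ 1# ∷ v ∷ [])
      ≈⟨ *-congˡ (D≈P R n q v) ⟨
    ((1# + u) / (1# + u * v)) ^ n * D n q v ∎)
  where
  open CommutativeRing R
  open GeneratingFunctions R
  open SetoidReasoning setoid
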